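{- Let $p$ be a prime number. For every $\lambda\in\overline{\mathbb{Q}}$ with $\lambda\neq 0$ and $\nu_p(\lambda)\neq 0$, the Belyi height of $\lambda$ satisfies $\mathcal{H}(\lambda)\geq p$.
   Context: Fix a prime $p$, an algebraic closure $\overline{\mathbb{Q}}_p$ of the field $\mathbb{Q}_p$ of $p$-adic numbers, and an algebraic closure $\overline{\mathbb{Q}}$ of $\mathbb{Q}$ embedded in $\overline{\mathbb{Q}}_p$. Let $\nu_p:\overline{\mathbb{Q}}_p\to\mathbb{R}\cup\{\infty\}$ be the $p$-adic valuation, i.e. the extension to $\overline{\mathbb{Q}}_p$ of the usual $p$-adic valuation on $\mathbb{Q}$ (with $\nu_p(p)=1$ and $\nu_p(0)=\infty$). A (normalized) Belyi polynomial is a nonconstant polynomial $B(x)\in\overline{\mathbb{Q}}[x]$ such that $B(0),B(1)\in\{0,1\}$ and $\{B(x_i): B'(x_i)=0\}\subset\{0,1\}$, i.e. every critical value of $B$ is $0$ or $1$. For $\lambda\in\overline{\mathbb{Q}}$, the Belyi height $\mathcal{H}(\lambda)$ is the minimal degree of a normalized Belyi polynomial $B$ with $B(\lambda)\in\{0,1\}$ (such a polynomial exists for every $\lambda\in\overline{\mathbb{Q}}$, by Belyi's construction). -}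

module Defs where

open import Level using (Level; _⊔_; 0ℓ) renaming (suc to lsuc)
open import Algebra.Bundles using (CommutativeRing)
open import Algebra.Morphism.Structures using (IsRingHomomorphism)
import Algebra.Properties.Semiring.Mult as SemiringMult
open import Data.Nat.Base as ℕ using (ℕ; zero; suc; _^_)
open import Data.Nat.Divisibility using (_∣?_)
open import Data.Integer.Base as ℤ using (∣_∣)
open import Data.List.Base using (List; []; _∷_; map; length; filter; upTo)
open import Data.Product.Base using (_×_; _,_; ∃-syntax)
open import Data.Rational.Base as ℚ using (ℚ; 0ℚ; 1ℚ; ↥_; ↧ₙ_)
import Data.Rational.Properties as ℚ
open import Data.Sum.Base using (_⊎_)
open import Function.Bundles using (_⇔_)
open import Relation.Binary.Construct.Add.Supremum.NonStrict ℚ._≤_ public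
  using (_≤⁺_)
open import Relation.Binary.PropositionalEquality.Core using (_≡_)
open import Relation.Nullary.Construct.Add.Supremum public
  using (_⁺; ⊤⁺; [_])
open import Relation.Nullary.Decidable.Core using (yes; no)

private
  variable
    c ℓ c₁ ℓ₁ c₂ ℓ₂ : Level

------------------------------------------------------------------------
-- Fields

-- Fields in the classical sense: every element different from 0 is
-- invertible.  In the library's HeytingField only elements apart from 0 are,
-- and there x ≉ 0# implies x # 0# only up to double negation.

record Field c ℓ : Set (lsuc (c ⊔ ℓ)) where
  field
    commutativeRing : CommutativeRing c ℓ

  open CommutativeRing commutativeRing public

  field
    1≉0     : 1# ≉ 0#
    inverse : ∀ x → x ≉ 0# → ∃[ y ] x * y ≈ 1#

IsFieldHomomorphism : (F : Field c₁ ℓ₁) (K : Field c₂ ℓ₂) →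
                      (Field.Carrier F → Field.Carrier K) → Set _
IsFieldHomomorphism F K = IsRingHomomorphism (Field.rawRing F) (Field.rawRing K)

ℚ-field : Field 0ℓ 0ℓ
ℚ-field = record
  { commutativeRing = ℚ.+-*-commutativeRing
  ; 1≉0             = λ ()
  ; inverse         = λ x x≢0 →
      let instance _ = ℚ.≢-nonZero x≢0 in ℚ.1/ x , ℚ.*-inverseʳ x
  }

------------------------------------------------------------------------
-- Univariate polynomials

module Polynomial (K : Field c ℓ) where
  open Field K
  open SemiringMult semiring using () renaming (_×_ to _·_)

  -- Coefficients in order of increasing degree; trailing zeros are allowed.
  Poly : Set c
  Poly = List Carrier

  coeff : Poly → ℕ → Carrier
  coeff []      _       = 0#
  coeff (a ∷ f) zero    = a
  coeff (a ∷ f) (suc n) = coeff f n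

  eval : Poly → Carrier → Carrier
  eval []      x = 0#
  eval (a ∷ f) x = a + x * eval f x

  -- derivativeFrom k f is the derivative of xᵏ f divided by xᵏ⁻¹.
  derivativeFrom : ℕ → Poly → Poly
  derivativeFrom k []      = []
  derivativeFrom k (a ∷ f) = k · a ∷ derivativeFrom (suc k) f

  derivative : Poly → Poly
  derivative []      = []
  derivative (a ∷ f) = derivativeFrom 1 f

  -- No degree is assigned to the zero polynomial.
  HasDegree : Poly → ℕ → Set ℓ
  HasDegree f n = coeff f n ≉ 0# × (∀ m → n ℕ.< m → coeff f m ≈ 0#)

------------------------------------------------------------------------
-- Algebraic closures

record IsAlgebraicClosure (F : Field c₁ ℓ₁) (K : Field c₂ ℓ₂)
                          (ι : Field.Carrier F → Field.Carrier K)
                          : Set (c₁ ⊔ ℓ₁ ⊔ c₂ ⊔ ℓ₂) where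
  private
    module F[x] = Polynomial F
    module K[x] = Polynomial K
  open Field K
  field
    isFieldHomomorphism : IsFieldHomomorphism F K ι
    algebraic           : ∀ x → ∃[ f ] ∃[ n ]
                          F[x].HasDegree f n × K[x].eval (map ι f) x ≈ 0#
    algebraicallyClosed : ∀ f n → K[x].HasDegree f (suc n) →
                          ∃[ x ] K[x].eval f x ≈ 0#

------------------------------------------------------------------------
-- Valuations with values in ℚ ∪ {∞}

infixl 6 _+⁺_
infixl 7 _⊓⁺_

_+⁺_ : ℚ ⁺ → ℚ ⁺ → ℚ ⁺
[ a ] +⁺ [ b ] = [ a ℚ.+ b ]
[ a ] +⁺ ⊤⁺    = ⊤⁺
⊤⁺    +⁺ b     = ⊤⁺

_⊓⁺_ : ℚ ⁺ → ℚ ⁺ → ℚ ⁺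
[ a ] ⊓⁺ [ b ] = [ a ℚ.⊓ b ]
[ a ] ⊓⁺ ⊤⁺    = [ a ]
⊤⁺    ⊓⁺ b     = b

record IsValuation (K : Field c ℓ) (ν : Field.Carrier K → ℚ ⁺)
                   : Set (c ⊔ ℓ) where
  open Field K
  field
    ν-cong  : ∀ {x y} → x ≈ y → ν x ≡ ν y
    ν≡∞⇔x≈0 : ∀ x → ν x ≡ ⊤⁺ ⇔ x ≈ 0#
    ν-*     : ∀ x y → ν (x * y) ≡ ν x +⁺ ν y
    ν-+     : ∀ x y → ν x ⊓⁺ ν y ≤⁺ ν (x + y)

module _ (K : Field c ℓ) (ν : Field.Carrier K → ℚ ⁺) where
  open Field K

  IsCauchy : (ℕ → Carrier) → Set
  IsCauchy s = ∀ (r : ℚ) → ∃[ N ] ∀ m n → N ℕ.≤ m → N ℕ.≤ n →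
               [ r ] ≤⁺ ν (s m - s n)

  ConvergesTo : (ℕ → Carrier) → Carrier → Set
  ConvergesTo s x = ∀ (r : ℚ) → ∃[ N ] ∀ n → N ℕ.≤ n → [ r ] ≤⁺ ν (s n - x)

record IsCompletion (F : Field c₁ ℓ₁) (νF : Field.Carrier F → ℚ ⁺)
                    (K : Field c₂ ℓ₂) (νK : Field.Carrier K → ℚ ⁺)
                    (ι : Field.Carrier F → Field.Carrier K)
                    : Set (c₁ ⊔ ℓ₁ ⊔ c₂ ⊔ ℓ₂) where
  open Field K
  field
    isFieldHomomorphism : IsFieldHomomorphism F K ι
    isValuation         : IsValuation K νK
    extends             : ∀ a → νK (ι a) ≡ νF a
    dense               : ∀ x (r : ℚ) → ∃[ a ] [ r ] ≤⁺ νK (x - ι a)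
    complete            : ∀ s → IsCauchy K νK s → ∃[ x ] ConvergesTo K νK s x

------------------------------------------------------------------------
-- p-adic numbers

-- The number of k with 1 ≤ k ≤ n and pᵏ ∣ n.  For p ≥ 2 and n ≥ 1 this is the
-- exponent of p in n, because pᵏ ∣ n forces k < pᵏ ≤ n.
multiplicity : ℕ → ℕ → ℕ
multiplicity p n = length (filter (λ k → p ^ suc k ∣? n) (upTo n))

ν-ℚ : ℕ → ℚ → ℚ ⁺
ν-ℚ p q with q ℚ.≟ 0ℚ
... | yes _ = ⊤⁺
... | no  _ = [ (multiplicity p ∣ ↥ q ∣ ℤ.⊖ multiplicity p (↧ₙ q)) ℚ./ 1 ]

IsPAdicNumbers : ℕ → (K : Field c ℓ) → (Field.Carrier K → ℚ ⁺) →
                 (ℚ → Field.Carrier K) → Set (c ⊔ ℓ)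
IsPAdicNumbers p K ν ι = IsCompletion ℚ-field (ν-ℚ p) K ν ι

-- The valuation of Q̄p extending that of Qp takes values in ℚ ∪ {∞}: if x has
-- minimal polynomial of degree n and constant coefficient a over Qp, then
-- n ν(x) = ν(a).
record IsExtendedValuation (F : Field c₁ ℓ₁) (νF : Field.Carrier F → ℚ ⁺)
                           (K : Field c₂ ℓ₂) (νK : Field.Carrier K → ℚ ⁺)
                           (ι : Field.Carrier F → Field.Carrier K)
                           : Set (c₁ ⊔ c₂ ⊔ ℓ₂) where
  field
    isValuation : IsValuation K νK
    extends     : ∀ a → νK (ι a) ≡ νF a

------------------------------------------------------------------------
-- Belyi polynomials and the Belyi height

module Belyi (Q̄ : Field c ℓ) where
  open Field Q̄
  open Polynomial Q̄

  Is0Or1 : Carrier → Set ℓ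
  Is0Or1 x = x ≈ 0# ⊎ x ≈ 1#

  record IsNormalizedBelyi (B : Poly) : Set (c ⊔ ℓ) where
    field
      nonconstant    : ∃[ n ] HasDegree B (suc n)
      B[0]           : Is0Or1 (eval B 0#)
      B[1]           : Is0Or1 (eval B 1#)
      criticalValues : ∀ x → eval (derivative B) x ≈ 0# → Is0Or1 (eval B x)

  HasBelyiOfDegree : Carrier → ℕ → Set (c ⊔ ℓ)
  HasBelyiOfDegree z n =
    ∃[ B ] IsNormalizedBelyi B × HasDegree B n × Is0Or1 (eval B z)

  -- "h is the minimum of the degrees".  A relation rather than a function,
  -- since a function would need Belyi's existence theorem.
  IsBelyiHeight : Carrier → ℕ → Set (c ⊔ ℓ)
  IsBelyiHeight z h =
    HasBelyiOfDegree z h × (∀ n → HasBelyiOfDegree z n → h ℕ.≤ n)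

{-# OPTIONS --safe #-}
module Submission where

open import Defs
open import Level using (Level; _⊔_; 0ℓ) renaming (suc to lsuc)
open import Algebra.Bundles using (CommutativeRing; RawRing)
open import Algebra.Morphism.Structures using (IsRingHomomorphism)
import Algebra.Properties.CommutativeSemiring.Exp as Exp
import Algebra.Properties.Semiring.Mult as SemiringMult
import Algebra.Solver.Ring as RingSolver
open import Algebra.Solver.Ring.AlmostCommutativeRing
  using (fromCommutativeRing; -raw-almostCommutative⟶; _-Raw-AlmostCommutative⟶_)
open import Data.Empty using (⊥)
import Data.Integer.Base as ℤ
import Data.Integer.Properties as ℤ
open import Data.List.Base using (List; []; _∷_; map; length; foldr; drop; replicate; filter; upTo)
import Data.List.Properties as List
open import Data.List.Relation.Unary.All as All using (All; []; _∷_)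
import Data.List.Relation.Unary.All.Properties as All
open import Data.Maybe.Base using (Maybe; just; nothing)
import Data.Nat.Coprimality as Coprimality
open import Data.Nat.Base as ℕ using (ℕ; zero; suc; s≤s; z≤n; _≥_)
open import Data.Nat.Divisibility using (_∣_; _∣?_; ∣⇒≤)
open import Data.Nat.Primality using (Prime)
import Data.Nat.Properties as ℕ
open import Data.Product.Base using (_×_; _,_; ∃; ∃-syntax; proj₁; proj₂)
open import Data.Rational.Base as ℚ using (ℚ; 0ℚ; 1ℚ; mkℚ)
import Data.Rational.Properties as ℚ
open import Algebra.Properties.Group ℚ.+-0-group using (identityʳ-unique)
import Data.Rational.Unnormalised.Base as ℚᵘ
import Data.Rational.Unnormalised.Properties as ℚᵘ
open import Data.Sum.Base using (_⊎_; inj₁; inj₂)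
open import Function.Base using (_∘_)
open import Function.Bundles using (module Equivalence)
open import Relation.Binary.Bundles using (Setoid)
import Relation.Binary.Construct.Add.Supremum.NonStrict ℚ._≤_ as ≤⁺
open ≤⁺ using ([_]; _≤⊤⁺)
open import Relation.Binary.Definitions using (Decidable)
open import Relation.Binary.PropositionalEquality as ≡ using (_≡_; _≢_)
import Relation.Binary.Reasoning.Setoid as SetoidReasoning
open import Relation.Nullary.Construct.Add.Point using ([]-injective)
open import Relation.Nullary.Decidable using (Dec; yes; no; ¬?; decidable-stable; map′)
open import Relation.Nullary.Negation using (¬_; contradiction)
open import Relation.Unary using (Pred)
import Relation.Unary as Unary

-- Let B have degree n < p.  Then the integers 1, …, n are units for νp, so
-- differentiation preserves the valuations of the nonconstant coefficients.
-- Put f = B - B(0) and suppose νp(λ) ≠ 0.  Let u and v be the points 1 and λ,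
-- ordered so that ∣u∣ > ∣v∣; the values of f at u, v and at the critical points
-- are among 0, 1 and -1.  If f exceeds 1 on the disc ∣x∣ ≤ ∣u∣, then all these
-- values are small compared with the maximum of f there.  Otherwise f is smaller
-- than 1 on the disc ∣x∣ ≤ ∣v∣, so it vanishes at v and at the critical points in
-- that disc.  In both cases f(wy), for w = u or w = v, divided by a coefficient of
-- largest absolute value reduces to a nonconstant polynomial g over the residue
-- field with g(0) = g(1) = 0, whose derivative splits and has only roots of g as
-- its roots.  As n < p, a root of multiplicity m of g′ has multiplicity m + 1 as a
-- root of g.  Hence x (x - 1) g′ divides g, which is impossible by degree.

-- The smallness of f on the inner disc is a Schwarz lemma: as f(0) = 0, every coefficient of f(vy)
-- carries at least one factor v/u more than that of f(uy), so ∣f∣ ≤ 1 on the outer disc becomes ∣f∣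
-- < 1 on the inner one. This is where νp(λ) ≠ 0 enters. A value among 0, 1 and -1 that is smaller
-- than 1 must be 0. B′ is split over the field of definition of B, because only critical points in
-- that field have prescribed values. The embedding and the rescaling carry the factorisation along.
-- On reduction a factor x - α with α outside the disc turns into a constant, so the reduced
-- derivative inherits a factorisation over the residue field itself. Multiplicities are treated
-- without unique factorisation: products of linear factors are indexed by explicit lists of roots,
-- the multiplicity of α is its number of occurrences, and the roots of g′ are transferred to g one
-- at a time. Degrees appear only as bounds beyond which coefficients vanish, since lists may end in
-- zeros.

-- Formal differences m - n of natural numbers serve as coefficients: unlike
-- elements of an arbitrary ring, their images can be compared.
module CommutativeRingSolver {c ℓ} (R : CommutativeRing c ℓ) where
  open CommutativeRing R
  open SemiringMult semiring using (×-homo-+; ×1-homo-*) renaming (_×_ to _·_)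
  open SetoidReasoning setoid

  private
    almostCommutativeRing = fromCommutativeRing R

    open RingSolver rawRing almostCommutativeRing
      (-raw-almostCommutative⟶ almostCommutativeRing) (λ _ _ → nothing)
      using (solve; _:=_; _:+_; _:*_; _:-_; :-_)

    differences : RawRing 0ℓ 0ℓ
    differences = record
      { Carrier = ℕ × ℕ
      ; _≈_     = _≡_
      ; _+_     = λ { (a , b) (c , d) → a ℕ.+ c , b ℕ.+ d }
      ; _*_     = λ { (a , b) (c , d) → a ℕ.* c ℕ.+ b ℕ.* d , a ℕ.* d ℕ.+ b ℕ.* c }
      ; -_      = λ { (a , b) → b , a }
      ; 0#      = 0 , 0
      ; 1#      = 1 , 0
      }

    ι : ℕ → Carrier
    ι n = n · 1#

    ⟦_⟧ : ℕ × ℕ → Carrier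
    ⟦ a , b ⟧ = ι a - ι b

    ι-+* : ∀ a b c d → ι (a ℕ.* b ℕ.+ c ℕ.* d) ≈ ι a * ι b + ι c * ι d
    ι-+* a b c d = trans (×-homo-+ 1# (a ℕ.* b) (c ℕ.* d))
                         (+-cong (×1-homo-* a b) (×1-homo-* c d))

    homomorphism : differences -Raw-AlmostCommutative⟶ almostCommutativeRing
    homomorphism = record
      { ⟦_⟧    = ⟦_⟧
      ; +-homo = λ { (a , b) (c , d) → begin
          ι (a ℕ.+ c) - ι (b ℕ.+ d)
            ≈⟨ +-cong (×-homo-+ 1# a c) (-‿cong (×-homo-+ 1# b d)) ⟩
          (ι a + ι c) - (ι b + ι d)      ≈⟨ solve 4 (λ a b c d → (a :+ c) :- (b :+ d) := (a :- b) :+ (c :- d))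
                                              refl (ι a) (ι b) (ι c) (ι d) ⟩
          (ι a - ι b) + (ι c - ι d)      ∎ }
      ; *-homo = λ { (a , b) (c , d) → begin
          ι (a ℕ.* c ℕ.+ b ℕ.* d) - ι (a ℕ.* d ℕ.+ b ℕ.* c)
            ≈⟨ +-cong (ι-+* a c b d) (-‿cong (ι-+* a d b c)) ⟩
          (ι a * ι c + ι b * ι d) - (ι a * ι d + ι b * ι c)
            ≈⟨ +-cong (+-congˡ (minus-minus (ι b) (ι d))) (sym (-‿+-comm _ _)) ⟩
          (ι a * ι c + - ι b * - ι d) + (- (ι a * ι d) - ι b * ι c)
            ≈⟨ +-congˡ (+-cong (-‿distribʳ-* (ι a) (ι d)) (-‿distribˡ-* (ι b) (ι c))) ⟩
          (ι a * ι c + - ι b * - ι d) + (ι a * - ι d + - ι b * ι c)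
            ≈⟨ solve 4 (λ a b c d → (a :* c :+ b :* d) :+ (a :* d :+ b :* c) :=
                                    (a :+ b) :* (c :+ d))
                 refl (ι a) (- ι b) (ι c) (- ι d) ⟩
          (ι a - ι b) * (ι c - ι d) ∎ }
      ; -‿homo = λ { (a , b) → begin
          ι b - ι a          ≈⟨ +-congʳ (-‿involutive (ι b)) ⟨
          - - ι b - ι a      ≈⟨ solve 2 (λ a b → :- b :- a := :- (a :+ b)) refl (ι a) (- ι b) ⟩
          - (ι a - ι b)      ∎ }
      ; 0-homo = -‿inverseʳ 0#
      ; 1-homo = begin
          (1# + 0#) - 0#  ≈⟨ +-cong (+-identityʳ 1#) -0#≈0# ⟩
          1# + 0#         ≈⟨ +-identityʳ 1# ⟩
          1#              ∎
      }
      where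
      open import Algebra.Properties.Ring ring using (-‿involutive; -0#≈0#; -‿+-comm; -‿distribˡ-*; -‿distribʳ-*)
      minus-minus : ∀ x y → x * y ≈ - x * - y
      minus-minus x y = begin
        x * y        ≈⟨ -‿involutive (x * y) ⟨
        - - (x * y)  ≈⟨ -‿cong (-‿distribʳ-* x y) ⟩
        - (x * - y)  ≈⟨ -‿distribˡ-* x (- y) ⟩
        - x * - y    ∎

    -- Only a positive answer is meaningful: differences with distinct values may still have equal
    -- images in positive characteristic, hence `Maybe`.
    _≟_ : ∀ x y → Maybe (⟦ x ⟧ ≈ ⟦ y ⟧)
    (a , b) ≟ (c , d) with a ℕ.+ d ℕ.≟ c ℕ.+ b
    ... | no  _   = nothing
    ... | yes a+d≡c+b = just (begin
      ι a - ι b                  ≈⟨ +-identityʳ _ ⟨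
      (ι a - ι b) + 0#           ≈⟨ +-congˡ (-‿inverseʳ (ι d)) ⟨
      (ι a - ι b) + (ι d - ι d)
        ≈⟨ solve 4
             (λ a b d d′ → (a :- b) :+ (d :+ d′) := (a :+ d) :+ (d′ :- b))
             refl (ι a) (ι b) (ι d) (- ι d) ⟩
      (ι a + ι d) + (- ι d - ι b)  ≈⟨ +-congʳ (×-homo-+ 1# a d) ⟨
      ι (a ℕ.+ d) + (- ι d - ι b)  ≈⟨ +-congʳ (reflexive (≡.cong ι a+d≡c+b)) ⟩
      ι (c ℕ.+ b) + (- ι d - ι b)  ≈⟨ +-congʳ (×-homo-+ 1# c b) ⟩
      (ι c + ι b) + (- ι d - ι b)
        ≈⟨ solve 4
             (λ c b b′ d → (c :+ b) :+ (d :+ b′) := (c :+ d) :+ (b :+ b′))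
             refl (ι c) (ι b) (- ι b) (- ι d) ⟩
      (ι c - ι d) + (ι b - ι b)  ≈⟨ +-congˡ (-‿inverseʳ (ι b)) ⟩
      (ι c - ι d) + 0#           ≈⟨ +-identityʳ _ ⟩
      ι c - ι d                  ∎)

  open RingSolver differences almostCommutativeRing homomorphism _≟_ public
    using (solve; _:=_; _:+_; _:*_; _:-_; :-_)

-- Polynomials over a field

module PolynomialProperties {c ℓ} (K : Field c ℓ) where
  open Field K
  open Polynomial K
  open CommutativeRingSolver commutativeRing
  open SemiringMult semiring using (×-congʳ; ×-congˡ; ×-assoc-*) renaming (_×_ to _·_)
  open import Algebra.Properties.Ring ring using (-0#≈0#; -1*x≈-x)
  open Exp commutativeSemiring using (_^_)
  open SetoidReasoning setoid

  infix  4 _≋_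
  infixl 6 _⊕_
  infixr 7 _⊛_

  -- Comparing coefficients makes trailing zeros invisible. A record, unlike a bare function type,
  -- lets unification recover f and g from a proof.
  record _≋_ (f g : Poly) : Set ℓ where
    constructor ≋-intro
    field
      at : ∀ n → coeff f n ≈ coeff g n

  open _≋_ public

  ≋-refl : ∀ {f} → f ≋ f
  ≋-refl .at n = refl

  ≋-sym : ∀ {f g} → f ≋ g → g ≋ f
  ≋-sym f≋g .at n = sym (f≋g .at n)

  ≋-trans : ∀ {f g h} → f ≋ g → g ≋ h → f ≋ h
  ≋-trans f≋g g≋h .at n = trans (f≋g .at n) (g≋h .at n)

  ≋-setoid : Setoid c ℓ
  ≋-setoid = record
    { Carrier       = Poly
    ; _≈_           = _≋_
    ; isEquivalence = record { refl = ≋-refl ; sym = ≋-sym ; trans = ≋-trans }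
    }

  module ≋-Reasoning = SetoidReasoning ≋-setoid

  tail-≋ : ∀ {a b f g} → a ∷ f ≋ b ∷ g → f ≋ g
  tail-≋ f≋g .at n = f≋g .at (suc n)

  tail-≋[] : ∀ {a f} → a ∷ f ≋ [] → f ≋ []
  tail-≋[] f≋[] .at n = f≋[] .at (suc n)

  _⊕_ : Poly → Poly → Poly
  []      ⊕ g       = g
  (a ∷ f) ⊕ []      = a ∷ f
  (a ∷ f) ⊕ (b ∷ g) = a + b ∷ f ⊕ g

  _⊛_ : Carrier → Poly → Poly
  a ⊛ f = map (a *_) f

  -- This is p + (x - α) f. The carry p is the coefficient that precedes those of f, which is what
  -- the recursion passes on.
  linear*From : Carrier → Carrier → Poly → Poly
  linear*From α p []      = p ∷ []
  linear*From α p (a ∷ f) = p - α * a ∷ linear*From α a f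

  -- (x - α) f
  linear* : Carrier → Poly → Poly
  linear* α f = linear*From α 0# f

  linears* : List Carrier → Poly → Poly
  linears* L f = foldr linear* f L

  -- (f - f(α)) / (x - α)
  divide : Carrier → Poly → Poly
  divide α []      = []
  divide α (a ∷ f) = eval f α ∷ divide α f

  coeff-⊕ : ∀ f g n → coeff (f ⊕ g) n ≈ coeff f n + coeff g n
  coeff-⊕ []      g       n       = sym (+-identityˡ _)
  coeff-⊕ (a ∷ f) []      n       = sym (+-identityʳ _)
  coeff-⊕ (a ∷ f) (b ∷ g) zero    = refl
  coeff-⊕ (a ∷ f) (b ∷ g) (suc n) = coeff-⊕ f g n

  coeff-⊛ : ∀ a f n → coeff (a ⊛ f) n ≈ a * coeff f n
  coeff-⊛ a []      n       = sym (zeroʳ a)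
  coeff-⊛ a (b ∷ f) zero    = refl
  coeff-⊛ a (b ∷ f) (suc n) = coeff-⊛ a f n

  x-y*0≈x : ∀ x y → x - y * 0# ≈ x
  x-y*0≈x x y = begin
    x - y * 0#  ≈⟨ +-congˡ (-‿cong (zeroʳ y)) ⟩
    x - 0#      ≈⟨ +-congˡ -0#≈0# ⟩
    x + 0#      ≈⟨ +-identityʳ x ⟩
    x           ∎

  coeff-linear*From-zero : ∀ α p f → coeff (linear*From α p f) 0 ≈ p - α * coeff f 0
  coeff-linear*From-zero α p []      = sym (x-y*0≈x p α)
  coeff-linear*From-zero α p (a ∷ f) = refl

  coeff-linear*From-suc : ∀ α p f n → coeff (linear*From α p f) (suc n) ≈
                                      coeff f n - α * coeff f (suc n)
  coeff-linear*From-suc α p []      n       = sym (x-y*0≈x 0# α)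
  coeff-linear*From-suc α p (a ∷ f) zero    = coeff-linear*From-zero α a f
  coeff-linear*From-suc α p (a ∷ f) (suc n) = coeff-linear*From-suc α a f n

  coeff-linear*-zero : ∀ α f → coeff (linear* α f) 0 ≈ - (α * coeff f 0)
  coeff-linear*-zero α f = trans (coeff-linear*From-zero α 0# f) (+-identityˡ _)

  coeff-linear*-suc : ∀ α f n → coeff (linear* α f) (suc n) ≈ coeff f n - α * coeff f (suc n)
  coeff-linear*-suc α = coeff-linear*From-suc α 0#

  -cong : ∀ {x y u v} → x ≈ y → u ≈ v → x - u ≈ y - v
  -cong x≈y u≈v = +-cong x≈y (-‿cong u≈v)

  linear*-cong : ∀ {α β f g} → α ≈ β → f ≋ g → linear* α f ≋ linear* β g
  linear*-cong {α} {β} {f} {g} α≈β f≋g .at zero = begin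
    coeff (linear* α f) 0  ≈⟨ coeff-linear*-zero α f ⟩
    - (α * coeff f 0)      ≈⟨ -‿cong (*-cong α≈β (f≋g .at 0)) ⟩
    - (β * coeff g 0)      ≈⟨ coeff-linear*-zero β g ⟨
    coeff (linear* β g) 0  ∎
  linear*-cong {α} {β} {f} {g} α≈β f≋g .at (suc n) = begin
    coeff (linear* α f) (suc n)        ≈⟨ coeff-linear*-suc α f n ⟩
    coeff f n - α * coeff f (suc n)    ≈⟨ -cong (f≋g .at n) (*-cong α≈β (f≋g .at (suc n))) ⟩
    coeff g n - β * coeff g (suc n)    ≈⟨ coeff-linear*-suc β g n ⟨
    coeff (linear* β g) (suc n)        ∎

  linears*-cong : ∀ L {f g} → f ≋ g → linears* L f ≋ linears* L g
  linears*-cong []      f≋g = f≋g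
  linears*-cong (α ∷ L) f≋g = linear*-cong refl (linears*-cong L f≋g)

  linear*-⊕ : ∀ α f g → linear* α (f ⊕ g) ≋ linear* α f ⊕ linear* α g
  linear*-⊕ α f g .at zero = begin
    coeff (linear* α (f ⊕ g)) 0                          ≈⟨ coeff-linear*-zero α (f ⊕ g) ⟩
    - (α * coeff (f ⊕ g) 0)                              ≈⟨ -‿cong (*-congˡ (coeff-⊕ f g 0)) ⟩
    - (α * (coeff f 0 + coeff g 0))
      ≈⟨ solve 3 (λ α x y → :- (α :* (x :+ y)) := :- (α :* x) :+ :- (α :* y)) refl _ _ _ ⟩
    - (α * coeff f 0) + - (α * coeff g 0)
      ≈⟨ +-cong (coeff-linear*-zero α f) (coeff-linear*-zero α g) ⟨
    coeff (linear* α f) 0 + coeff (linear* α g) 0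
      ≈⟨ coeff-⊕ (linear* α f) (linear* α g) 0 ⟨
    coeff (linear* α f ⊕ linear* α g) 0                  ∎
  linear*-⊕ α f g .at (suc n) = begin
    coeff (linear* α (f ⊕ g)) (suc n)                    ≈⟨ coeff-linear*-suc α (f ⊕ g) n ⟩
    coeff (f ⊕ g) n - α * coeff (f ⊕ g) (suc n)
      ≈⟨ -cong (coeff-⊕ f g n) (*-congˡ (coeff-⊕ f g (suc n))) ⟩
    (coeff f n + coeff g n) - α * (coeff f (suc n) + coeff g (suc n))
      ≈⟨ solve 5
           (λ α x y x′ y′ → (x :+ y) :- α :* (x′ :+ y′) := (x :- α :* x′) :+ (y :- α :* y′))
           refl _ _ _ _ _ ⟩
    (coeff f n - α * coeff f (suc n)) + (coeff g n - α * coeff g (suc n))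
      ≈⟨ +-cong (coeff-linear*-suc α f n) (coeff-linear*-suc α g n) ⟨
    coeff (linear* α f) (suc n) + coeff (linear* α g) (suc n)
      ≈⟨ coeff-⊕ (linear* α f) (linear* α g) (suc n) ⟨
    coeff (linear* α f ⊕ linear* α g) (suc n)                  ∎

  linear*-⊛ : ∀ α a f → linear* α (a ⊛ f) ≋ a ⊛ linear* α f
  linear*-⊛ α a f .at zero = begin
    coeff (linear* α (a ⊛ f)) 0    ≈⟨ coeff-linear*-zero α (a ⊛ f) ⟩
    - (α * coeff (a ⊛ f) 0)        ≈⟨ -‿cong (*-congˡ (coeff-⊛ a f 0)) ⟩
    - (α * (a * coeff f 0))
      ≈⟨ solve 3 (λ α a x → :- (α :* (a :* x)) := a :* (:- (α :* x))) refl _ _ _ ⟩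
    a * - (α * coeff f 0)          ≈⟨ *-congˡ (coeff-linear*-zero α f) ⟨
    a * coeff (linear* α f) 0      ≈⟨ coeff-⊛ a (linear* α f) 0 ⟨
    coeff (a ⊛ linear* α f) 0      ∎
  linear*-⊛ α a f .at (suc n) = begin
    coeff (linear* α (a ⊛ f)) (suc n)                ≈⟨ coeff-linear*-suc α (a ⊛ f) n ⟩
    coeff (a ⊛ f) n - α * coeff (a ⊛ f) (suc n)
      ≈⟨ -cong (coeff-⊛ a f n) (*-congˡ (coeff-⊛ a f (suc n))) ⟩
    a * coeff f n - α * (a * coeff f (suc n))
      ≈⟨ solve 4 (λ α a x y → a :* x :- α :* (a :* y) := a :* (x :- α :* y)) refl _ _ _ _ ⟩
    a * (coeff f n - α * coeff f (suc n))            ≈⟨ *-congˡ (coeff-linear*-suc α f n) ⟨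
    a * coeff (linear* α f) (suc n)                  ≈⟨ coeff-⊛ a (linear* α f) (suc n) ⟨
    coeff (a ⊛ linear* α f) (suc n)                  ∎

  linear*-comm : ∀ α β f → linear* α (linear* β f) ≋ linear* β (linear* α f)
  linear*-comm α β f .at zero = begin
    coeff (linear* α (linear* β f)) 0    ≈⟨ coeff-linear*-zero α (linear* β f) ⟩
    - (α * coeff (linear* β f) 0)        ≈⟨ -‿cong (*-congˡ (coeff-linear*-zero β f)) ⟩
    - (α * - (β * coeff f 0))
      ≈⟨ solve 3 (λ α β x → :- (α :* :- (β :* x)) := :- (β :* :- (α :* x))) refl _ _ _ ⟩
    - (β * - (α * coeff f 0))            ≈⟨ -‿cong (*-congˡ (coeff-linear*-zero α f)) ⟨
    - (β * coeff (linear* α f) 0)        ≈⟨ coeff-linear*-zero β (linear* α f) ⟨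
    coeff (linear* β (linear* α f)) 0    ∎
  linear*-comm α β f .at (suc zero) = begin
    coeff (linear* α (linear* β f)) 1
      ≈⟨ coeff-linear*-suc α (linear* β f) 0 ⟩
    coeff (linear* β f) 0 - α * coeff (linear* β f) 1
      ≈⟨ -cong (coeff-linear*-zero β f) (*-congˡ (coeff-linear*-suc β f 0)) ⟩
    - (β * coeff f 0) - α * (coeff f 0 - β * coeff f 1)
      ≈⟨ solve 4
           (λ α β x y → :- (β :* x) :- α :* (x :- β :* y) := :- (α :* x) :- β :* (x :- α :* y))
           refl _ _ _ _ ⟩
    - (α * coeff f 0) - β * (coeff f 0 - α * coeff f 1)
      ≈⟨ -cong (coeff-linear*-zero α f) (*-congˡ (coeff-linear*-suc α f 0)) ⟨
    coeff (linear* α f) 0 - β * coeff (linear* α f) 1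
      ≈⟨ coeff-linear*-suc β (linear* α f) 0 ⟨
    coeff (linear* β (linear* α f)) 1                              ∎
  linear*-comm α β f .at (suc (suc n)) = begin
    coeff (linear* α (linear* β f)) (2 ℕ.+ n)
      ≈⟨ coeff-linear*-suc α (linear* β f) (1 ℕ.+ n) ⟩
    coeff (linear* β f) (1 ℕ.+ n) - α * coeff (linear* β f) (2 ℕ.+ n)
      ≈⟨ -cong (coeff-linear*-suc β f n) (*-congˡ (coeff-linear*-suc β f (1 ℕ.+ n))) ⟩
    (coeff f n - β * coeff f (1 ℕ.+ n)) - α * (coeff f (1 ℕ.+ n) - β * coeff f (2 ℕ.+ n))
      ≈⟨ solve 5
           (λ α β x y z → (x :- β :* y) :- α :* (y :- β :* z) := (x :- α :* y) :- β :* (y :- α :* z))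
           refl _ _ _ _ _ ⟩
    (coeff f n - α * coeff f (1 ℕ.+ n)) - β * (coeff f (1 ℕ.+ n) - α * coeff f (2 ℕ.+ n))
      ≈⟨ -cong (coeff-linear*-suc α f n) (*-congˡ (coeff-linear*-suc α f (1 ℕ.+ n))) ⟨
    coeff (linear* α f) (1 ℕ.+ n) - β * coeff (linear* α f) (2 ℕ.+ n)
      ≈⟨ coeff-linear*-suc β (linear* α f) (1 ℕ.+ n) ⟨
    coeff (linear* β (linear* α f)) (2 ℕ.+ n)                                  ∎

  linear*-linears* : ∀ α L f → linear* α (linears* L f) ≋ linears* L (linear* α f)
  linear*-linears* α []      f = ≋-refl
  linear*-linears* α (β ∷ L) f = ≋-trans (linear*-comm α β (linears* L f))
                                         (linear*-cong refl (linear*-linears* α L f))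

  linears*-⊛ : ∀ L a f → linears* L (a ⊛ f) ≋ a ⊛ linears* L f
  linears*-⊛ []      a f = ≋-refl
  linears*-⊛ (α ∷ L) a f = ≋-trans (linear*-cong refl (linears*-⊛ L a f)) (linear*-⊛ α a (linears* L f))

  -- Evaluation and division by linear factors

  eval-[] : ∀ {f} → f ≋ [] → ∀ x → eval f x ≈ 0#
  eval-[] {[]}    f≋[] x = refl
  eval-[] {a ∷ f} f≋[] x = begin
    a + x * eval f x  ≈⟨ +-cong (f≋[] .at 0) (*-congˡ (eval-[] (tail-≋[] f≋[]) x)) ⟩
    0# + x * 0#       ≈⟨ +-identityˡ _ ⟩
    x * 0#            ≈⟨ zeroʳ x ⟩
    0#                ∎

  eval-cong : ∀ {f g x y} → f ≋ g → x ≈ y → eval f x ≈ eval g y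
  eval-cong {[]}    {g}     f≋g x≈y = sym (eval-[] (≋-sym f≋g) _)
  eval-cong {a ∷ f} {[]}    f≋g x≈y = eval-[] f≋g _
  eval-cong {a ∷ f} {b ∷ g} f≋g x≈y =
    +-cong (f≋g .at 0) (*-cong x≈y (eval-cong (tail-≋ f≋g) x≈y))

  eval-⊕ : ∀ f g x → eval (f ⊕ g) x ≈ eval f x + eval g x
  eval-⊕ []      g       x = sym (+-identityˡ _)
  eval-⊕ (a ∷ f) []      x = sym (+-identityʳ _)
  eval-⊕ (a ∷ f) (b ∷ g) x = begin
    (a + b) + x * eval (f ⊕ g) x               ≈⟨ +-congˡ (*-congˡ (eval-⊕ f g x)) ⟩
    (a + b) + x * (eval f x + eval g x)
      ≈⟨ solve 5
           (λ a b x u v → (a :+ b) :+ x :* (u :+ v) := (a :+ x :* u) :+ (b :+ x :* v))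
           refl _ _ _ _ _ ⟩
    (a + x * eval f x) + (b + x * eval g x)    ∎

  eval-⊛ : ∀ a f x → eval (a ⊛ f) x ≈ a * eval f x
  eval-⊛ a []      x = sym (zeroʳ a)
  eval-⊛ a (b ∷ f) x = begin
    a * b + x * eval (a ⊛ f) x    ≈⟨ +-congˡ (*-congˡ (eval-⊛ a f x)) ⟩
    a * b + x * (a * eval f x)
      ≈⟨ solve 4 (λ a b x u → a :* b :+ x :* (a :* u) := a :* (b :+ x :* u)) refl _ _ _ _ ⟩
    a * (b + x * eval f x)        ∎

  eval-linear*From : ∀ α p f x → eval (linear*From α p f) x ≈ p + (x - α) * eval f x
  eval-linear*From α p []      x = +-congˡ (trans (zeroʳ x) (sym (zeroʳ (x - α))))
  eval-linear*From α p (a ∷ f) x = begin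
    (p - α * a) + x * eval (linear*From α a f) x
      ≈⟨ +-congˡ (*-congˡ (eval-linear*From α a f x)) ⟩
    (p - α * a) + x * (a + (x - α) * eval f x)
      ≈⟨ solve 5
           (λ p α a x u → (p :- α :* a) :+ x :* (a :+ (x :- α) :* u) :=
             p :+ (x :- α) :* (a :+ x :* u))
           refl _ _ _ _ _ ⟩
    p + (x - α) * (a + x * eval f x)                  ∎

  eval-linear* : ∀ α f x → eval (linear* α f) x ≈ (x - α) * eval f x
  eval-linear* α f x = trans (eval-linear*From α 0# f x) (+-identityˡ _)

  eval-linear*-root : ∀ α f → eval (linear* α f) α ≈ 0#
  eval-linear*-root α f = begin
    eval (linear* α f) α  ≈⟨ eval-linear* α f α ⟩
    (α - α) * eval f α    ≈⟨ *-congʳ (-‿inverseʳ α) ⟩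
    0# * eval f α         ≈⟨ zeroˡ _ ⟩
    0#                    ∎

  coeff-divide-zero : ∀ α f → coeff f 0 ≈ eval f α - α * coeff (divide α f) 0
  coeff-divide-zero α []          = sym (x-y*0≈x 0# α)
  coeff-divide-zero α (a ∷ [])    = begin
    a                     ≈⟨ +-identityʳ a ⟨
    a + 0#                ≈⟨ +-congˡ (zeroʳ α) ⟨
    a + α * 0#            ≈⟨ x-y*0≈x _ α ⟨
    a + α * 0# - α * 0#   ∎
  coeff-divide-zero α (a ∷ f@(_ ∷ _)) = solve 3 (λ a α u → a := (a :+ α :* u) :- α :* u) refl a α (eval f α)

  coeff-divide-suc : ∀ α f n → coeff f (suc n) ≈
                     coeff (divide α f) n - α * coeff (divide α f) (suc n)
  coeff-divide-suc α []      n       = sym (x-y*0≈x 0# α)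
  coeff-divide-suc α (a ∷ f) zero    = coeff-divide-zero α f
  coeff-divide-suc α (a ∷ f) (suc n) = coeff-divide-suc α f n

  linear*-divide : ∀ α f → eval f α ≈ 0# → f ≋ linear* α (divide α f)
  linear*-divide α f f[α]≈0 .at zero = begin
    coeff f 0                                ≈⟨ coeff-divide-zero α f ⟩
    eval f α - α * coeff (divide α f) 0      ≈⟨ +-congʳ f[α]≈0 ⟩
    0# - α * coeff (divide α f) 0            ≈⟨ +-identityˡ _ ⟩
    - (α * coeff (divide α f) 0)             ≈⟨ coeff-linear*-zero α (divide α f) ⟨
    coeff (linear* α (divide α f)) 0         ∎
  linear*-divide α f f[α]≈0 .at (suc n) =
    trans (coeff-divide-suc α f n) (sym (coeff-linear*-suc α (divide α f) n))

  x-y≈0⇒x≈y : ∀ {x y} → x - y ≈ 0# → x ≈ y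
  x-y≈0⇒x≈y {x} {y} x-y≈0 = begin
    x            ≈⟨ solve 2 (λ x y → x := (x :- y) :+ y) refl x y ⟩
    (x - y) + y  ≈⟨ +-congʳ x-y≈0 ⟩
    0# + y       ≈⟨ +-identityˡ y ⟩
    y            ∎

  x≈y⇒x-y≈0 : ∀ {x y} → x ≈ y → x - y ≈ 0#
  x≈y⇒x-y≈0 {x} {y} x≈y = trans (+-congʳ x≈y) (-‿inverseʳ y)

  -- The coefficients are 0 past the end of the list, and the relation carries this 0 back to the
  -- start.
  geometric⇒≋[] : ∀ α f → (∀ n → coeff f n ≈ α * coeff f (suc n)) → f ≋ []
  geometric⇒≋[] α []      geo .at n       = refl
  geometric⇒≋[] α (a ∷ f) geo .at zero    = begin
    a              ≈⟨ geo 0 ⟩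
    α * coeff f 0  ≈⟨ *-congˡ (geometric⇒≋[] α f (λ n → geo (suc n)) .at 0) ⟩
    α * 0#         ≈⟨ zeroʳ α ⟩
    0#             ∎
  geometric⇒≋[] α (a ∷ f) geo .at (suc n) = geometric⇒≋[] α f (λ n → geo (suc n)) .at n

  coeff-drop : ∀ m f n → coeff (drop m f) n ≡ coeff f (m ℕ.+ n)
  coeff-drop zero    f       n = ≡.refl
  coeff-drop (suc m) []      n = ≡.refl
  coeff-drop (suc m) (a ∷ f) n = coeff-drop m f n

  VanishesFrom : ℕ → Poly → Set ℓ
  VanishesFrom m f = ∀ n → m ℕ.≤ n → coeff f n ≈ 0#

  -- Where the coefficients of (x - α) f vanish, each coefficient of f is α times the next, so the
  -- tail of f is a geometric sequence in a finite list.
  linear*-vanishesFrom⁻ : ∀ {m} α f → VanishesFrom (suc m) (linear* α f) → VanishesFrom m f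
  linear*-vanishesFrom⁻ {m} α f vanishes n m≤n = begin
    coeff f n                          ≡⟨ ≡.cong (coeff f) (ℕ.m+[n∸m]≡n m≤n) ⟨
    coeff f (m ℕ.+ (n ℕ.∸ m))          ≡⟨ coeff-drop m f (n ℕ.∸ m) ⟨
    coeff (drop m f) (n ℕ.∸ m)         ≈⟨ geometric⇒≋[] α (drop m f) geometric .at (n ℕ.∸ m) ⟩
    0#                                 ∎
    where
    geometric : ∀ k → coeff (drop m f) k ≈ α * coeff (drop m f) (suc k)
    geometric k = begin
      coeff (drop m f) k             ≡⟨ coeff-drop m f k ⟩
      coeff f (m ℕ.+ k)              ≈⟨ x-y≈0⇒x≈y (trans (sym (coeff-linear*-suc α f (m ℕ.+ k)))
                                                         (vanishes _ (s≤s (ℕ.m≤m+n m k)))) ⟩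
      α * coeff f (suc (m ℕ.+ k))    ≡⟨ ≡.cong (λ i → α * coeff f i) (ℕ.+-suc m k) ⟨
      α * coeff f (m ℕ.+ suc k)      ≡⟨ ≡.cong (α *_) (coeff-drop m f (suc k)) ⟨
      α * coeff (drop m f) (suc k)   ∎

  -- The degree argument in the form used later: a multiple of as many linear factors as `L` has
  -- entries can have smaller degree only if it is 0.
  linears*-vanishesFrom⁻ : ∀ L f → VanishesFrom (length L) (linears* L f) → f ≋ []
  linears*-vanishesFrom⁻ []      f vanishes .at n = vanishes n z≤n
  linears*-vanishesFrom⁻ (α ∷ L) f vanishes =
    linears*-vanishesFrom⁻ L f (linear*-vanishesFrom⁻ α (linears* L f) vanishes)

  ⊕-cong : ∀ {f f′ g g′} → f ≋ f′ → g ≋ g′ → f ⊕ g ≋ f′ ⊕ g′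
  ⊕-cong {f} {f′} {g} {g′} f≋f′ g≋g′ .at n = begin
    coeff (f ⊕ g) n             ≈⟨ coeff-⊕ f g n ⟩
    coeff f n + coeff g n       ≈⟨ +-cong (f≋f′ .at n) (g≋g′ .at n) ⟩
    coeff f′ n + coeff g′ n     ≈⟨ coeff-⊕ f′ g′ n ⟨
    coeff (f′ ⊕ g′) n           ∎

  -- The difference h of f and g satisfies (x - α) h = 0, which again makes its coefficients a
  -- geometric sequence.
  linear*-injective : ∀ α f g → linear* α f ≋ linear* α g → f ≋ g
  linear*-injective α f g eq .at n =
    x-y≈0⇒x≈y (trans (sym (coeff-h n)) (geometric⇒≋[] α h geometric .at n))
    where
    h = f ⊕ - 1# ⊛ g

    coeff-h : ∀ n → coeff h n ≈ coeff f n - coeff g n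
    coeff-h n = begin
      coeff h n                         ≈⟨ coeff-⊕ f (- 1# ⊛ g) n ⟩
      coeff f n + coeff (- 1# ⊛ g) n    ≈⟨ +-congˡ (coeff-⊛ (- 1#) g n) ⟩
      coeff f n + - 1# * coeff g n      ≈⟨ +-congˡ (-1*x≈-x _) ⟩
      coeff f n - coeff g n             ∎

    geometric : ∀ n → coeff h n ≈ α * coeff h (suc n)
    geometric n = x-y≈0⇒x≈y (begin
      coeff h n - α * coeff h (suc n)
        ≈⟨ -cong (coeff-h n) (*-congˡ (coeff-h (suc n))) ⟩
      (coeff f n - coeff g n) - α * (coeff f (suc n) - coeff g (suc n))
        ≈⟨ solve 5
             (λ α x y x′ y′ → (x :- y) :- α :* (x′ :- y′) := (x :- α :* x′) :- (y :- α :* y′))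
             refl _ _ _ _ _ ⟩
      (coeff f n - α * coeff f (suc n)) - (coeff g n - α * coeff g (suc n))
        ≈⟨ x≈y⇒x-y≈0 (trans (sym (coeff-linear*-suc α f n)) (trans (eq .at (suc n)) (coeff-linear*-suc α g n))) ⟩
      0# ∎)

  linears*-injective : ∀ L f g → linears* L f ≋ linears* L g → f ≋ g
  linears*-injective []      f g eq = eq
  linears*-injective (α ∷ L) f g eq =
    linears*-injective L f g (linear*-injective α (linears* L f) (linears* L g) eq)

  linears*-⊕ : ∀ L f g → linears* L (f ⊕ g) ≋ linears* L f ⊕ linears* L g
  linears*-⊕ []      f g = ≋-refl
  linears*-⊕ (α ∷ L) f g = ≋-trans (linear*-cong refl (linears*-⊕ L f g))
                                   (linear*-⊕ α (linears* L f) (linears* L g))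

  -- Derivatives and multiple roots

  ·-zeroʳ : ∀ n → n · 0# ≈ 0#
  ·-zeroʳ zero    = refl
  ·-zeroʳ (suc n) = trans (+-identityˡ _) (·-zeroʳ n)

  coeff-derivativeFrom : ∀ k f n → coeff (derivativeFrom k f) n ≈ (k ℕ.+ n) · coeff f n
  coeff-derivativeFrom k []      n       = sym (·-zeroʳ (k ℕ.+ n))
  coeff-derivativeFrom k (a ∷ f) zero    = ×-congˡ (≡.sym (ℕ.+-identityʳ k))
  coeff-derivativeFrom k (a ∷ f) (suc n) =
    trans (coeff-derivativeFrom (suc k) f n) (×-congˡ (≡.sym (ℕ.+-suc k n)))

  coeff-derivative : ∀ f n → coeff (derivative f) n ≈ (suc n · 1#) * coeff f (suc n)
  coeff-derivative []      n = sym (zeroʳ _)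
  coeff-derivative (a ∷ f) n = begin
    coeff (derivativeFrom 1 f) n  ≈⟨ coeff-derivativeFrom 1 f n ⟩
    suc n · coeff f n             ≈⟨ ×-congʳ (suc n) (*-identityˡ _) ⟨
    suc n · (1# * coeff f n)      ≈⟨ ×-assoc-* (suc n) 1# _ ⟨
    (suc n · 1#) * coeff f n      ∎

  derivative-cong : ∀ {f g} → f ≋ g → derivative f ≋ derivative g
  derivative-cong {f} {g} f≋g .at n = begin
    coeff (derivative f) n            ≈⟨ coeff-derivative f n ⟩
    (suc n · 1#) * coeff f (suc n)    ≈⟨ *-congˡ (f≋g .at (suc n)) ⟩
    (suc n · 1#) * coeff g (suc n)    ≈⟨ coeff-derivative g n ⟨
    coeff (derivative g) n            ∎

  derivative-linear* : ∀ α f → derivative (linear* α f) ≋ f ⊕ linear* α (derivative f)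
  derivative-linear* α f .at zero = begin
    coeff (derivative (linear* α f)) 0                ≈⟨ coeff-derivative (linear* α f) 0 ⟩
    (1# + 0#) * coeff (linear* α f) 1
      ≈⟨ *-cong (+-identityʳ 1#) (coeff-linear*-suc α f 0) ⟩
    1# * (coeff f 0 - α * coeff f 1)
      ≈⟨ solve 4 (λ o α x y → o :* (x :- α :* y) := o :* x :+ :- (α :* (o :* y))) refl _ _ _ _ ⟩
    1# * coeff f 0 + - (α * (1# * coeff f 1))
      ≈⟨ +-cong (*-identityˡ _) (-‿cong (*-congˡ (trans (*-congʳ (sym (+-identityʳ 1#))) (sym (coeff-derivative f 0))))) ⟩
    coeff f 0 + - (α * coeff (derivative f) 0)
      ≈⟨ +-congˡ (coeff-linear*-zero α (derivative f)) ⟨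
    coeff f 0 + coeff (linear* α (derivative f)) 0    ≈⟨ coeff-⊕ f _ 0 ⟨
    coeff (f ⊕ linear* α (derivative f)) 0            ∎
  derivative-linear* α f .at (suc n) = begin
    coeff (derivative (linear* α f)) (suc n)
      ≈⟨ coeff-derivative (linear* α f) (suc n) ⟩
    (1# + m) * coeff (linear* α f) (2 ℕ.+ n)
      ≈⟨ *-congˡ (coeff-linear*-suc α f (suc n)) ⟩
    (1# + m) * (x - α * y)
      ≈⟨ solve 5
           (λ o m α x y → (o :+ m) :* (x :- α :* y) :=
             o :* x :+ (m :* x :- α :* ((o :+ m) :* y)))
           refl _ _ _ _ _ ⟩
    1# * x + (m * x - α * ((1# + m) * y))
      ≈⟨ +-cong (*-identityˡ x) (-cong (sym (coeff-derivative f n)) (*-congˡ (sym (coeff-derivative f (suc n))))) ⟩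
    x + (coeff (derivative f) n - α * coeff (derivative f) (suc n))
                                                      ≈⟨ +-congˡ (coeff-linear*-suc α (derivative f) n) ⟨
    x + coeff (linear* α (derivative f)) (suc n)      ≈⟨ coeff-⊕ f _ (suc n) ⟨
    coeff (f ⊕ linear* α (derivative f)) (suc n)      ∎
    where
    m = suc n · 1#
    x = coeff f (suc n)
    y = coeff f (2 ℕ.+ n)

  -- k f + (x - α) f′, that is, (x - α) times the derivative of (x - α)ᵏ f,
  -- divided by (x - α)ᵏ.
  euler : Carrier → ℕ → Poly → Poly
  euler α zero    f = linear* α (derivative f)
  euler α (suc k) f = f ⊕ euler α k f

  -- The product rule. The extra factor x - α replaces the exponent k - 1 by k, so that k = 0 is no
  -- exception.
  linear*-derivative : ∀ α k f → linear* α (derivative (linears* (replicate k α) f)) ≋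
                                 linears* (replicate k α) (euler α k f)
  linear*-derivative α zero    f = ≋-refl
  linear*-derivative α (suc k) f = linear*-cong refl (≋R.begin
    derivative (linear* α g)               ≋R.≈⟨ derivative-linear* α g ⟩
    g ⊕ linear* α (derivative g)           ≋R.≈⟨ ⊕-cong ≋-refl (linear*-derivative α k f) ⟩
    g ⊕ linears* (replicate k α) (euler α k f)
      ≋R.≈⟨ linears*-⊕ (replicate k α) f (euler α k f) ⟨
    linears* (replicate k α) (f ⊕ euler α k f) ≋R.∎)
    where
    module ≋R = ≋-Reasoning
    g = linears* (replicate k α) f

  -- The term (x - α) f′ drops out at α. What remains shows that α is no further root of the
  -- derivative unless k or f(α) is 0 in the field.
  eval-euler : ∀ α k f → eval (euler α k f) α ≈ (k · 1#) * eval f α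
  eval-euler α zero    f = trans (eval-linear*-root α (derivative f)) (sym (zeroˡ _))
  eval-euler α (suc k) f = begin
    eval (f ⊕ euler α k f) α                 ≈⟨ eval-⊕ f (euler α k f) α ⟩
    eval f α + eval (euler α k f) α
      ≈⟨ +-cong (*-identityˡ _) (sym (eval-euler α k f)) ⟨
    1# * eval f α + (k · 1#) * eval f α      ≈⟨ distribʳ _ _ _ ⟨
    (1# + k · 1#) * eval f α                 ∎

  x*y≈0∧x≉0⇒y≈0 : ∀ {x y} → x * y ≈ 0# → x ≉ 0# → y ≈ 0#
  x*y≈0∧x≉0⇒y≈0 {x} {y} x*y≈0 x≉0 with inverse x x≉0
  ... | x⁻¹ , x*x⁻¹≈1 = begin
    y              ≈⟨ *-identityˡ y ⟨
    1# * y         ≈⟨ *-congʳ x*x⁻¹≈1 ⟨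
    x * x⁻¹ * y    ≈⟨ solve 3 (λ x x⁻¹ y → x :* x⁻¹ :* y := x⁻¹ :* (x :* y)) refl x x⁻¹ y ⟩
    x⁻¹ * (x * y)  ≈⟨ *-congˡ x*y≈0 ⟩
    x⁻¹ * 0#       ≈⟨ zeroʳ x⁻¹ ⟩
    0#             ∎

  eval-linear*-root⁻ : ∀ {α x} f → x ≉ α → eval (linear* α f) x ≈ 0# → eval f x ≈ 0#
  eval-linear*-root⁻ {α} {x} f x≉α eq =
    x*y≈0∧x≉0⇒y≈0 (trans (sym (eval-linear* α f x)) eq) (x≉α ∘ x-y≈0⇒x≈y)

  eval-linears*-root⁻ : ∀ {L x} f → All (x ≉_) L → eval (linears* L f) x ≈ 0# → eval f x ≈ 0#
  eval-linears*-root⁻ {[]}    f []            eq = eq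
  eval-linears*-root⁻ {α ∷ L} f (x≉α ∷ x≉L) eq =
    eval-linears*-root⁻ f x≉L (eval-linear*-root⁻ (linears* L f) x≉α eq)

  linear*-vanishesFrom : ∀ {m} α f → VanishesFrom m f → VanishesFrom (suc m) (linear* α f)
  linear*-vanishesFrom α f vanishes (suc n) (s≤s m≤n) = begin
    coeff (linear* α f) (suc n)      ≈⟨ coeff-linear*-suc α f n ⟩
    coeff f n - α * coeff f (suc n)
      ≈⟨ -cong (vanishes n m≤n) (*-congˡ (vanishes (suc n) (ℕ.m≤n⇒m≤1+n m≤n))) ⟩
    0# - α * 0#                      ≈⟨ x-y*0≈x 0# α ⟩
    0#                               ∎

  linears*-constant-vanishesFrom : ∀ L a → VanishesFrom (suc (length L)) (linears* L (a ∷ []))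
  linears*-constant-vanishesFrom []      a (suc n) _ = refl
  linears*-constant-vanishesFrom (α ∷ L) a =
    linear*-vanishesFrom α (linears* L (a ∷ [])) (linears*-constant-vanishesFrom L a)

  coeff-linears*-top : ∀ L a → coeff (linears* L (a ∷ [])) (length L) ≈ a
  coeff-linears*-top []      a = refl
  coeff-linears*-top (α ∷ L) a = begin
    coeff (linear* α f) (suc (length L))                ≈⟨ coeff-linear*-suc α f (length L) ⟩
    coeff f (length L) - α * coeff f (suc (length L))
      ≈⟨ -cong (coeff-linears*-top L a) (*-congˡ (linears*-constant-vanishesFrom L a _ ℕ.≤-refl)) ⟩
    a - α * 0#                                          ≈⟨ x-y*0≈x a α ⟩
    a                                                   ∎
    where f = linears* L (a ∷ [])

  linears*-zero : ∀ L {f} → f ≋ [] → linears* L f ≋ []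
  linears*-zero L {f} f≋[] .at n = begin
    coeff (linears* L f) n              ≈⟨ linears*-cong L f≋[] .at n ⟩
    coeff (linears* L (0# ⊛ [])) n      ≈⟨ linears*-⊛ L 0# [] .at n ⟩
    coeff (0# ⊛ linears* L []) n        ≈⟨ coeff-⊛ 0# (linears* L []) n ⟩
    0# * coeff (linears* L []) n        ≈⟨ zeroˡ _ ⟩
    0#                                  ∎

  linears*-replicate-+ : ∀ m n α f → linears* (replicate (m ℕ.+ n) α) f ≡
                         linears* (replicate m α) (linears* (replicate n α) f)
  linears*-replicate-+ zero    n α f = ≡.refl
  linears*-replicate-+ (suc m) n α f = ≡.cong (linear* α) (linears*-replicate-+ m n α f)

  linears*-roots : ∀ L f → All (λ α → eval (linears* L f) α ≈ 0#) L
  linears*-roots []      f = []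
  linears*-roots (α ∷ L) f = eval-linear*-root α (linears* L f)
    ∷ All.map (λ {β} root → trans (eval-linear* α (linears* L f) β) (trans (*-congˡ root) (zeroʳ _)))
              (linears*-roots L f)

  split : (∀ f n → HasDegree f (suc n) → ∃[ x ] eval f x ≈ 0#) →
          ∀ n f → HasDegree f n → ∃[ L ] ∃[ a ] f ≋ linears* L (a ∷ [])
  split closed zero    f (_ , vanishes) =
    [] , coeff f 0 , ≋-intro λ { zero → refl ; (suc n) → vanishes (suc n) (s≤s z≤n) }
  split closed (suc n) f deg@(fₙ≉0 , vanishes) with closed f n deg
  ... | α , f[α]≈0 =
    let L , a , q≋ = split closed n q (qₙ≉0 , q-vanishes)
    in α ∷ L , a , ≋-trans f≋ (linear*-cong refl q≋)
    where
    q = divide α f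

    f≋ : f ≋ linear* α q
    f≋ = linear*-divide α f f[α]≈0

    q-vanishes : VanishesFrom (suc n) q
    q-vanishes = linear*-vanishesFrom⁻ α q (λ m n<m → trans (sym (f≋ .at m)) (vanishes m n<m))

    qₙ≉0 : coeff q n ≉ 0#
    qₙ≉0 qₙ≈0 = fₙ≉0 (begin
      coeff f (suc n)                    ≈⟨ coeff-divide-suc α f n ⟩
      coeff q n - α * coeff q (suc n)    ≈⟨ -cong qₙ≈0 (*-congˡ (q-vanishes (suc n) ℕ.≤-refl)) ⟩
      0# - α * 0#                        ≈⟨ x-y*0≈x 0# α ⟩
      0#                                 ∎)

  -- Rescaling the variable

  dilate : Carrier → Poly → Poly
  dilate w []      = []
  dilate w (a ∷ f) = a ∷ w ⊛ dilate w f

  coeff-dilate : ∀ w f n → coeff (dilate w f) n ≈ w ^ n * coeff f n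
  coeff-dilate w []      n       = sym (zeroʳ _)
  coeff-dilate w (a ∷ f) zero    = sym (*-identityˡ a)
  coeff-dilate w (a ∷ f) (suc n) = begin
    coeff (w ⊛ dilate w f) n    ≈⟨ coeff-⊛ w (dilate w f) n ⟩
    w * coeff (dilate w f) n    ≈⟨ *-congˡ (coeff-dilate w f n) ⟩
    w * (w ^ n * coeff f n)     ≈⟨ *-assoc w _ _ ⟨
    w ^ suc n * coeff f n       ∎

  eval-dilate : ∀ w f x → eval (dilate w f) x ≈ eval f (w * x)
  eval-dilate w []      x = refl
  eval-dilate w (a ∷ f) x = +-congˡ (begin
    x * eval (w ⊛ dilate w f) x    ≈⟨ *-congˡ (eval-⊛ w (dilate w f) x) ⟩
    x * (w * eval (dilate w f) x)
      ≈⟨ solve 3 (λ x w y → x :* (w :* y) := w :* x :* y) refl x w _ ⟩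
    w * x * eval (dilate w f) x    ≈⟨ *-congˡ (eval-dilate w f x) ⟩
    w * x * eval f (w * x)         ∎)

  dilate-cong : ∀ w {f g} → f ≋ g → dilate w f ≋ dilate w g
  dilate-cong w {f} {g} f≋g .at n = begin
    coeff (dilate w f) n  ≈⟨ coeff-dilate w f n ⟩
    w ^ n * coeff f n     ≈⟨ *-congˡ (f≋g .at n) ⟩
    w ^ n * coeff g n     ≈⟨ coeff-dilate w g n ⟨
    coeff (dilate w g) n  ∎

  ⊛-cong : ∀ a {f g} → f ≋ g → a ⊛ f ≋ a ⊛ g
  ⊛-cong a {f} {g} f≋g .at n = begin
    coeff (a ⊛ f) n  ≈⟨ coeff-⊛ a f n ⟩
    a * coeff f n    ≈⟨ *-congˡ (f≋g .at n) ⟩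
    a * coeff g n    ≈⟨ coeff-⊛ a g n ⟨
    coeff (a ⊛ g) n  ∎

  module _ {w w⁻¹ : Carrier} (ww⁻¹≈1 : w * w⁻¹ ≈ 1#) where

    ww⁻¹x≈x : ∀ x → w * (w⁻¹ * x) ≈ x
    ww⁻¹x≈x x = begin
      w * (w⁻¹ * x)  ≈⟨ *-assoc w w⁻¹ x ⟨
      w * w⁻¹ * x    ≈⟨ *-congʳ ww⁻¹≈1 ⟩
      1# * x         ≈⟨ *-identityˡ x ⟩
      x              ∎

    dilate-linear* : ∀ α f → dilate w (linear* α f) ≋ w ⊛ linear* (w⁻¹ * α) (dilate w f)
    dilate-linear* α f .at zero = begin
      coeff (dilate w (linear* α f)) 0                ≈⟨ coeff-dilate w (linear* α f) 0 ⟩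
      1# * coeff (linear* α f) 0
        ≈⟨ trans (*-identityˡ _) (coeff-linear*-zero α f) ⟩
      - (α * coeff f 0)                               ≈⟨ -‿cong (*-congʳ (ww⁻¹x≈x α)) ⟨
      - (w * (w⁻¹ * α) * coeff f 0)
        ≈⟨ solve 3 (λ w β x → :- (w :* β :* x) := w :* (:- (β :* x))) refl w (w⁻¹ * α) _ ⟩
      w * - (w⁻¹ * α * coeff f 0)
        ≈⟨ *-congˡ (-‿cong (*-congˡ (trans (coeff-dilate w f 0) (*-identityˡ _)))) ⟨
      w * - (w⁻¹ * α * coeff (dilate w f) 0)
        ≈⟨ *-congˡ (coeff-linear*-zero _ (dilate w f)) ⟨
      w * coeff (linear* (w⁻¹ * α) (dilate w f)) 0
        ≈⟨ coeff-⊛ w (linear* (w⁻¹ * α) (dilate w f)) 0 ⟨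
      coeff (w ⊛ linear* (w⁻¹ * α) (dilate w f)) 0    ∎
    dilate-linear* α f .at (suc n) = begin
      coeff (dilate w (linear* α f)) (suc n)          ≈⟨ coeff-dilate w (linear* α f) (suc n) ⟩
      w * w ^ n * coeff (linear* α f) (suc n)
        ≈⟨ *-congˡ (trans (coeff-linear*-suc α f n) (+-congˡ (-‿cong (*-congʳ (sym (ww⁻¹x≈x α)))))) ⟩
      w * w ^ n * (coeff f n - w * (w⁻¹ * α) * coeff f (suc n))
        ≈⟨ solve 5
             (λ w wⁿ x β y → w :* wⁿ :* (x :- w :* β :* y) := w :* (wⁿ :* x :- β :* (w :* wⁿ :* y)))
             refl w (w ^ n) _ (w⁻¹ * α) _ ⟩
      w * (w ^ n * coeff f n - w⁻¹ * α * (w ^ suc n * coeff f (suc n)))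
        ≈⟨ *-congˡ (-cong (coeff-dilate w f n) (*-congˡ (coeff-dilate w f (suc n)))) ⟨
      w * (coeff (dilate w f) n - w⁻¹ * α * coeff (dilate w f) (suc n))
        ≈⟨ *-congˡ (coeff-linear*-suc _ (dilate w f) n) ⟨
      w * coeff (linear* (w⁻¹ * α) (dilate w f)) (suc n)
        ≈⟨ coeff-⊛ w (linear* (w⁻¹ * α) (dilate w f)) (suc n) ⟨
      coeff (w ⊛ linear* (w⁻¹ * α) (dilate w f)) (suc n)    ∎

    -- Substituting w x divides every root by w. The constant absorbs a power of w; only the roots
    -- matter later, so it stays existential.
    dilate-linears* : ∀ L a → ∃[ b ] dilate w (linears* L (a ∷ [])) ≋ linears* (map (w⁻¹ *_) L) (b ∷ [])
    dilate-linears* []      a = a , ≋-refl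
    dilate-linears* (α ∷ L) a with dilate-linears* L a
    ... | b , f≋ = w * b , (≋R.begin
      dilate w (linear* α f)                                ≋R.≈⟨ dilate-linear* α f ⟩
      w ⊛ linear* (w⁻¹ * α) (dilate w f)
        ≋R.≈⟨ ⊛-cong w (linear*-cong refl f≋) ⟩
      w ⊛ linears* (map (w⁻¹ *_) (α ∷ L)) (b ∷ [])
        ≋R.≈⟨ linears*-⊛ (map (w⁻¹ *_) (α ∷ L)) w (b ∷ []) ⟨
      linears* (map (w⁻¹ *_) (α ∷ L)) (w * b ∷ [])          ≋R.∎)
      where
      module ≋R = ≋-Reasoning
      f = linears* L (a ∷ [])

  -- 0# ∷ rescale b w t is b f(w x) where f = 0# ∷ t.
  rescale : Carrier → Carrier → Poly → Poly
  rescale b w t = b ⊛ w ⊛ dilate w t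

  coeff-rescale : ∀ b w t n → coeff (rescale b w t) n ≈ b * (w ^ suc n * coeff t n)
  coeff-rescale b w t n = begin
    coeff (b ⊛ w ⊛ dilate w t) n      ≈⟨ coeff-⊛ b (w ⊛ dilate w t) n ⟩
    b * coeff (w ⊛ dilate w t) n      ≈⟨ *-congˡ (coeff-dilate w (0# ∷ t) (suc n)) ⟩
    b * (w ^ suc n * coeff t n)       ∎

  eval-rescale : ∀ b w t x → eval (0# ∷ rescale b w t) x ≈ b * eval (0# ∷ t) (w * x)
  eval-rescale b w t x = begin
    0# + x * eval (b ⊛ w ⊛ dilate w t) x
      ≈⟨ +-congˡ (*-congˡ (eval-⊛ b (w ⊛ dilate w t) x)) ⟩
    0# + x * (b * eval (w ⊛ dilate w t) x)
      ≈⟨ trans (+-identityˡ _) (solve 3 (λ x b y → x :* (b :* y) := b :* (x :* y)) refl x b _) ⟩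
    b * (x * eval (w ⊛ dilate w t) x)          ≈⟨ *-congˡ (+-identityˡ _) ⟨
    b * eval (dilate w (0# ∷ t)) x             ≈⟨ *-congˡ (eval-dilate w (0# ∷ t) x) ⟩
    b * eval (0# ∷ t) (w * x)                  ∎

  derivative-rescale : ∀ b w t → derivative (0# ∷ rescale b w t) ≋ (b * w) ⊛ dilate w (derivative (0# ∷ t))
  derivative-rescale b w t .at n = begin
    coeff (derivative (0# ∷ rescale b w t)) n
      ≈⟨ coeff-derivative (0# ∷ rescale b w t) n ⟩
    (suc n · 1#) * coeff (rescale b w t) n            ≈⟨ *-congˡ (coeff-rescale b w t n) ⟩
    (suc n · 1#) * (b * (w * w ^ n * coeff t n))
      ≈⟨ solve 5
           (λ m b w wⁿ x → m :* (b :* (w :* wⁿ :* x)) := b :* w :* (wⁿ :* (m :* x)))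
           refl (suc n · 1#) b w (w ^ n) _ ⟩
    b * w * (w ^ n * ((suc n · 1#) * coeff t n))
      ≈⟨ *-congˡ (*-congˡ (coeff-derivative (0# ∷ t) n)) ⟨
    b * w * (w ^ n * coeff (derivative (0# ∷ t)) n)
      ≈⟨ *-congˡ (coeff-dilate w (derivative (0# ∷ t)) n) ⟨
    b * w * coeff (dilate w (derivative (0# ∷ t))) n
      ≈⟨ coeff-⊛ (b * w) (dilate w (derivative (0# ∷ t))) n ⟨
    coeff ((b * w) ⊛ dilate w (derivative (0# ∷ t))) n ∎

  -- Multiplicities as numbers of occurrences

  module DecidableEquality (_≟_ : Decidable _≈_) where
    count : Carrier → List Carrier → ℕ
    count α L = length (filter (_≟ α) L)

    others : Carrier → List Carrier → List Carrier
    others α L = filter (λ β → ¬? (β ≟ α)) L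

    linears*-extract : ∀ α L f → linears* L f ≋
                       linears* (replicate (count α L) α) (linears* (others α L) f)
    linears*-extract α []      f = ≋-refl
    linears*-extract α (β ∷ L) f with β ≟ α
    ... | yes β≈α = linear*-cong β≈α (linears*-extract α L f)
    ... | no  _   = ≋-trans (linear*-cong refl (linears*-extract α L f))
                            (linear*-linears* β (replicate (count α L) α) _)

    count-∷ : ∀ {α β} L → β ≉ α → count α (β ∷ L) ≡ count α L
    count-∷ {α} {β} L β≉α with β ≟ α
    ... | yes β≈α = contradiction β≈α β≉α
    ... | no  _   = ≡.refl

    count-self : ∀ α L → count α (α ∷ L) ≡ suc (count α L)
    count-self α L with α ≟ α
    ... | yes _   = ≡.refl
    ... | no  α≉α = contradiction refl α≉α

    count-∷-≤ : ∀ α β L → count α (β ∷ L) ℕ.≤ suc (count α L)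
    count-∷-≤ α β L with β ≟ α
    ... | yes _ = ℕ.≤-refl
    ... | no  _ = ℕ.n≤1+n _

    -- The additional roots a and b of g use up, at any single α, at most the one unit of
    -- multiplicity by which g exceeds g′.
    count-distinct : ∀ {α a b} L → a ≉ b → count α (a ∷ b ∷ L) ℕ.≤ suc (count α L)
    count-distinct {α} {a} {b} L a≉b with a ≟ α
    ... | no  _   = count-∷-≤ α b L
    ... | yes a≈α = s≤s (ℕ.≤-reflexive (count-∷ L (λ b≈α → a≉b (trans a≈α (sym b≈α)))))

    -- The multiplicity of α as a root of g exceeds by one its multiplicity as
    -- a root of g′.
    cofactor-root : ∀ g M q L h α →
                    g ≋ linears* M q → derivative g ≋ linears* L h → eval g α ≈ 0# →
                    count α M ℕ.≤ count α L →
                    (∀ k → count α M ≡ suc k → suc k · 1# ≉ 0#) →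
                    eval q α ≈ 0#
    cofactor-root g M q L h α g≋ g′≋ g[α]≈0 k≤l k≉0 =
      -- No entry of `others α M` equals α, so if w vanishes at α, the factor q is responsible.
      eval-linears*-root⁻ q (All.map (_∘ sym) (All.all-filter (λ β → ¬? (β ≟ α)) M))
        (w[α]≈0 (count α M) ≡.refl)
      where
      module ≋R = ≋-Reasoning

      w = linears* (others α M) q

      w[α]≈0 : ∀ k → count α M ≡ k → eval w α ≈ 0#
      w[α]≈0 zero    count≡0 = begin
        eval w α
          ≡⟨ ≡.cong (λ n → eval (linears* (replicate n α) w) α) count≡0 ⟨
        eval (linears* (replicate (count α M) α) w) α
          ≈⟨ eval-cong (linears*-extract α M q) refl ⟨
        eval (linears* M q) α                             ≈⟨ eval-cong g≋ refl ⟨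
        eval g α                                          ≈⟨ g[α]≈0 ⟩
        0#                                                ∎
      -- Both g and g′ contain (x - α)ᵐ. Cancelling it from (x - α) g′ leaves `euler α m w` on one
      -- side and a multiple of x - α on the other; evaluation at α gives m w(α) = 0, where m is
      -- invertible.
      w[α]≈0 (suc k) count≡1+k = x*y≈0∧x≉0⇒y≈0 (begin
        (suc k · 1#) * eval w α         ≡⟨ ≡.cong (λ n → (n · 1#) * eval w α) count≡1+k ⟨
        (m · 1#) * eval w α             ≈⟨ eval-euler α m w ⟨
        eval (euler α m w) α            ≈⟨ eval-cong euler≋ refl ⟩
        eval (linear* α h₁) α           ≈⟨ eval-linear*-root α h₁ ⟩
        0#                              ∎) (k≉0 k count≡1+k)
        where
        m = count α M
        d = count α L ℕ.∸ m
        h₁ = linears* (replicate d α) (linears* (others α L) h)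

        euler≋ : euler α m w ≋ linear* α h₁
        euler≋ = linears*-injective (replicate m α) _ _ (≋R.begin
          linears* (replicate m α) (euler α m w)
            ≋R.≈⟨ linear*-derivative α m w ⟨
          linear* α (derivative (linears* (replicate m α) w))
            ≋R.≈⟨ linear*-cong refl (derivative-cong (≋-trans g≋ (linears*-extract α M q))) ⟨
          linear* α (derivative g)
            ≋R.≈⟨ linear*-cong refl (≋-trans g′≋ (linears*-extract α L h)) ⟩
          linear* α (linears* (replicate (count α L) α) (linears* (others α L) h))
            ≋R.≡⟨ ≡.cong (λ n → linear* α (linears* (replicate n α) (linears* (others α L) h))) (ℕ.m+[n∸m]≡n k≤l) ⟨
          linear* α (linears* (replicate (m ℕ.+ d) α) (linears* (others α L) h))
            ≋R.≡⟨ ≡.cong (linear* α) (linears*-replicate-+ m d α _) ⟩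
          linear* α (linears* (replicate m α) h₁)
            ≋R.≈⟨ linear*-linears* α (replicate m α) h₁ ⟩
          linears* (replicate m α) (linear* α h₁)                 ≋R.∎)

    count≤length : ∀ α L → count α L ℕ.≤ length L
    count≤length α L = List.length-filter (_≟ α) L

    -- Induction on `L`, with the roots not yet treated hidden in the cofactor h of g′. The next
    -- root α occurs in `a ∷ b ∷ L` at most once more than in `L`, hence no more often than in
    -- `α ∷ L`, and `cofactor-root` finds it in q. The bound N keeps the multiplicities nonzero in
    -- the field.
    roots-of-derivative : ∀ g a b N L h →
                          a ≉ b → eval g a ≈ 0# → eval g b ≈ 0# →
                          (∀ k → suc k ℕ.≤ N → suc k · 1# ≉ 0#) → length L ℕ.≤ N →
                          derivative g ≋ linears* L h → All (λ α → eval g α ≈ 0#) L →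
                          ∃[ q ] g ≋ linears* (a ∷ b ∷ L) q
    roots-of-derivative g a b N []      h a≉b g[a]≈0 g[b]≈0 N! L≤N g′≋ [] =
      divide b q , ≋-trans g≋ (linear*-cong refl (linear*-divide b q q[b]≈0))
      where
      q = divide a g

      g≋ : g ≋ linear* a q
      g≋ = linear*-divide a g g[a]≈0

      q[b]≈0 : eval q b ≈ 0#
      q[b]≈0 = eval-linear*-root⁻ q (a≉b ∘ sym) (trans (sym (eval-cong g≋ refl)) g[b]≈0)
    roots-of-derivative g a b N (α ∷ L) h a≉b g[a]≈0 g[b]≈0 N! L<N g′≋ (g[α]≈0 ∷ g[L]≈0)
      with roots-of-derivative g a b N L (linear* α h) a≉b g[a]≈0 g[b]≈0 N! (ℕ.<⇒≤ L<N)
             (≋-trans g′≋ (linear*-linears* α L h)) g[L]≈0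
    ... | q , g≋ = divide α q , (≋R.begin
      g                                                  ≋R.≈⟨ g≋ ⟩
      linears* (a ∷ b ∷ L) q
        ≋R.≈⟨ linears*-cong (a ∷ b ∷ L) (linear*-divide α q q[α]≈0) ⟩
      linears* (a ∷ b ∷ L) (linear* α (divide α q))
        ≋R.≈⟨ linears*-cong (a ∷ b ∷ []) (linear*-linears* α L _) ⟨
      linears* (a ∷ b ∷ α ∷ L) (divide α q)              ≋R.∎)
      where
      module ≋R = ≋-Reasoning

      count≤ : count α (a ∷ b ∷ L) ℕ.≤ suc (count α L)
      count≤ = count-distinct L a≉b

      q[α]≈0 : eval q α ≈ 0#
      q[α]≈0 = cofactor-root g (a ∷ b ∷ L) q (α ∷ L) h α g≋ g′≋ g[α]≈0
        (ℕ.≤-trans count≤ (ℕ.≤-reflexive (≡.sym (count-self α L))))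
        (λ k count≡1+k → N! k (begin-≤ k count≡1+k))
        where
        begin-≤ : ∀ k → count α (a ∷ b ∷ L) ≡ suc k → suc k ℕ.≤ N
        begin-≤ k count≡1+k = ℕ.≤-trans (ℕ.≤-reflexive (≡.sym count≡1+k))
          (ℕ.≤-trans count≤ (ℕ.≤-trans (s≤s (count≤length α L)) L<N))

    coeff-suc≈0 : ∀ g N → (∀ k → suc k ℕ.≤ N → suc k · 1# ≉ 0#) → VanishesFrom (suc N) g →
                  ∀ n → coeff (derivative g) n ≈ 0# → coeff g (suc n) ≈ 0#
    coeff-suc≈0 g N N! vanishes n g′ₙ≈0 with n ℕ.<? N
    ... | yes n<N = x*y≈0∧x≉0⇒y≈0 (trans (sym (coeff-derivative g n)) g′ₙ≈0) (N! n n<N)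
    ... | no  n≮N = vanishes (suc n) (s≤s (ℕ.≮⇒≥ n≮N))

    -- If c is 0, then g′ is 0 and the integers up to N can be cancelled. Otherwise the length of
    -- `L` is the degree of g′, so g has degree at most one more, while it is divisible by two
    -- linear factors more; this forces g = 0.
    distinct-roots⇒constant : ∀ g a b N L c →
                              a ≉ b → eval g a ≈ 0# → eval g b ≈ 0# →
                              (∀ k → suc k ℕ.≤ N → suc k · 1# ≉ 0#) → VanishesFrom (suc N) g →
                              derivative g ≋ linears* L (c ∷ []) → All (λ α → eval g α ≈ 0#) L →
                              ∀ n → coeff g (suc n) ≈ 0#
    distinct-roots⇒constant g a b N L c a≉b g[a]≈0 g[b]≈0 N! vanishes g′≋ g[L]≈0 n
      with c ≟ 0#
    ... | yes c≈0 = coeff-suc≈0 g N N! vanishes n (g′≋[] .at n)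
      where
      g′≋[] : derivative g ≋ []
      g′≋[] = ≋-trans g′≋ (linears*-zero L (≋-intro λ { zero → c≈0 ; (suc _) → refl }))
    ... | no c≉0 = g≋[] .at (suc n)
      where
      g-vanishes : VanishesFrom (2 ℕ.+ length L) g
      g-vanishes (suc n) (s≤s L<n) = coeff-suc≈0 g N N! vanishes n
        (trans (g′≋ .at n) (linears*-constant-vanishesFrom L c n L<n))

      L≤N : length L ℕ.≤ N
      L≤N = ℕ.≮⇒≥ λ N<L → c≉0 (begin
        c                                                        ≈⟨ coeff-linears*-top L c ⟨
        coeff (linears* L (c ∷ [])) (length L)                   ≈⟨ g′≋ .at (length L) ⟨
        coeff (derivative g) (length L)
          ≈⟨ coeff-derivative g (length L) ⟩
        (suc (length L) · 1#) * coeff g (suc (length L))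
          ≈⟨ *-congˡ (vanishes _ (ℕ.m≤n⇒m≤1+n N<L)) ⟩
        (suc (length L) · 1#) * 0#                               ≈⟨ zeroʳ _ ⟩
        0#                                                       ∎)

      g≋[] : g ≋ []
      g≋[] with roots-of-derivative g a b N L (c ∷ []) a≉b g[a]≈0 g[b]≈0 N! L≤N g′≋ g[L]≈0
      ... | q , g≋ = ≋-trans g≋ (linears*-zero (a ∷ b ∷ L) (linears*-vanishesFrom⁻ (a ∷ b ∷ L) q
                       (λ m L≤m → trans (sym (g≋ .at m)) (g-vanishes m L≤m))))

-- Valuation rings and their residue fields

-- The predicates stand for ∣x∣ ≤ 1 and ∣x∣ < 1. Sizes are compared only through membership of
-- quotients, so no value group occurs; decidability serves the case distinctions on sizes.
record ValuationRing {c ℓ} (K : Field c ℓ) p : Set (c ⊔ ℓ ⊔ lsuc p) where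
  open Field K
  field
    O M           : Pred Carrier p
    O?            : Unary.Decidable O
    M?            : Unary.Decidable M
    O-resp        : ∀ {x y} → x ≈ y → O x → O y
    M-resp        : ∀ {x y} → x ≈ y → M x → M y
    M⇒O           : ∀ {x} → M x → O x
    0∈M           : M 0#
    1∈O           : O 1#
    1∉M           : ¬ M 1#
    O-+           : ∀ {x y} → O x → O y → O (x + y)
    O-*           : ∀ {x y} → O x → O y → O (x * y)
    O-neg         : ∀ {x} → O x → O (- x)
    M-+           : ∀ {x y} → M x → M y → M (x + y)
    M-*           : ∀ {x y} → O x → M y → M (x * y)
    inverse∈M     : ∀ {x y} → x * y ≈ 1# → ¬ O x → M y
    inverse∈O     : ∀ {x y} → x * y ≈ 1# → ¬ M x → O y

module ValuationRingProperties {c ℓ p} {K : Field c ℓ} (V : ValuationRing K p) where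
  open Field K
  open ValuationRing V
  open PolynomialProperties K
  open CommutativeRingSolver commutativeRing
  open Polynomial K
  open SemiringMult semiring using () renaming (_×_ to _·_)
  open Exp commutativeSemiring using (_^_; ^-distrib-*)
  open SetoidReasoning setoid
  open import Algebra.Properties.Ring ring using (-1*x≈-x; -0#≈0#)

  0∈O : O 0#
  0∈O = M⇒O 0∈M

  ≈⇒M : ∀ {x y} → x ≈ y → M (x - y)
  ≈⇒M x≈y = M-resp (sym (x≈y⇒x-y≈0 x≈y)) 0∈M

  O-- : ∀ {x y} → O x → O y → O (x - y)
  O-- x∈O y∈O = O-+ x∈O (O-neg y∈O)

  M-neg : ∀ {x} → M x → M (- x)
  M-neg {x} x∈M = M-resp (-1*x≈-x x) (M-* (O-neg 1∈O) x∈M)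

  private
    _≈ₖ_ : ∃ O → ∃ O → Set p
    (x , _) ≈ₖ (y , _) = M (x - y)

  -- A residue class is represented by an element of O, with congruence modulo M
  -- as the equality.
  residueRing : CommutativeRing (c ⊔ p) p
  residueRing = record
    { Carrier = ∃ O
    ; _≈_ = _≈ₖ_
    ; _+_ = λ { (x , x∈O) (y , y∈O) → x + y , O-+ x∈O y∈O }
    ; _*_ = λ { (x , x∈O) (y , y∈O) → x * y , O-* x∈O y∈O }
    ; -_  = λ { (x , x∈O) → - x , O-neg x∈O }
    ; 0#  = 0# , 0∈O
    ; 1#  = 1# , 1∈O
    ; isCommutativeRing = record
      { isRing = record
        { +-isAbelianGroup = record
          { isGroup = record
            { isMonoid = record
              { isSemigroup = record
                { isMagma = record
                  { isEquivalence = record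
                    { refl  = ≈⇒M refl
                    ; sym   = λ {(x , _)} {(y , _)} x≈y → M-resp
                        (solve 2 (λ x y → :- (x :- y) := y :- x) refl x y) (M-neg x≈y)
                    ; trans = λ {(x , _)} {(y , _)} {(z , _)} x≈y y≈z → M-resp
                        (solve 3 (λ x y z → (x :- y) :+ (y :- z) := x :- z) refl x y z) (M-+ x≈y y≈z)
                    }
                  ; ∙-cong = λ {(x , _)} {(y , _)} {(u , _)} {(v , _)} x≈y u≈v → M-resp
                      (solve 4 (λ x y u v → (x :- y) :+ (u :- v) := (x :+ u) :- (y :+ v)) refl x y u v)
                      (M-+ x≈y u≈v)
                  }
                ; assoc = λ (x , _) (y , _) (z , _) → ≈⇒M (+-assoc x y z)
                }
              ; identity = (λ (x , _) → ≈⇒M (+-identityˡ x)) , (λ (x , _) → ≈⇒M (+-identityʳ x))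
              }
            ; inverse = (λ (x , _) → ≈⇒M (-‿inverseˡ x)) , (λ (x , _) → ≈⇒M (-‿inverseʳ x))
            ; ⁻¹-cong = λ {(x , _)} {(y , _)} x≈y → M-resp
                (solve 2 (λ x y → :- (x :- y) := :- x :- :- y) refl x y) (M-neg x≈y)
            }
          ; comm = λ (x , _) (y , _) → ≈⇒M (+-comm x y)
          }
        ; *-cong = λ {(x , x∈O)} {(y , _)} {(u , _)} {(v , v∈O)} x≈y u≈v → M-resp
            (solve 4 (λ x y u v → x :* (u :- v) :+ v :* (x :- y) := x :* u :- y :* v) refl x y u v)
            (M-+ (M-* x∈O u≈v) (M-* v∈O x≈y))
        ; *-assoc = λ (x , _) (y , _) (z , _) → ≈⇒M (*-assoc x y z)
        ; *-identity = (λ (x , _) → ≈⇒M (*-identityˡ x)) , (λ (x , _) → ≈⇒M (*-identityʳ x))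
        ; distrib = (λ (x , _) (y , _) (z , _) → ≈⇒M (distribˡ x y z))
                  , (λ (x , _) (y , _) (z , _) → ≈⇒M (distribʳ x y z))
        }
      ; *-comm = λ (x , _) (y , _) → ≈⇒M (*-comm x y)
      }
    }

  x-0≈x : ∀ x → x - 0# ≈ x
  x-0≈x x = trans (+-congˡ -0#≈0#) (+-identityʳ x)

  residueField : Field (c ⊔ p) p
  residueField = record
    { commutativeRing = residueRing
    ; 1≉0     = 1∉M ∘ M-resp (x-0≈x 1#)
    ; inverse = λ (x , x∈O) x≉0 →
        let x∉M       = x≉0 ∘ M-resp (sym (x-0≈x x))
            y , x*y≈1 = inverse x (λ x≈0 → x∉M (M-resp (sym x≈0) 0∈M))
        in (y , inverse∈O x*y≈1 x∉M) , ≈⇒M x*y≈1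
    }

  -- Reduction of polynomials modulo the maximal ideal

  private
    module k = Field residueField
    module k[x] = Polynomial residueField
    module kP = PolynomialProperties residueField

    _≟ₖ_ : Decidable k._≈_
    (x , _) ≟ₖ (y , _) = M? (x - y)

    module kD = kP.DecidableEquality _≟ₖ_
    module k× = SemiringMult k.semiring

  -- Residue classes are computed with on representatives, so lifting commutes with all operations
  -- up to `≡`, not merely modulo M.
  lift : k[x].Poly → Poly
  lift = map proj₁

  coeff-lift : ∀ H n → coeff (lift H) n ≡ proj₁ (k[x].coeff H n)
  coeff-lift []      n       = ≡.refl
  coeff-lift (a ∷ H) zero    = ≡.refl
  coeff-lift (a ∷ H) (suc n) = coeff-lift H n

  eval-lift : ∀ H x → eval (lift H) (proj₁ x) ≡ proj₁ (k[x].eval H x)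
  eval-lift []      x = ≡.refl
  eval-lift (a ∷ H) x = ≡.cong (λ y → proj₁ a + proj₁ x * y) (eval-lift H x)

  ×-lift : ∀ n x → proj₁ (n k×.× x) ≡ n · proj₁ x
  ×-lift zero    x = ≡.refl
  ×-lift (suc n) x = ≡.cong (proj₁ x +_) (×-lift n x)

  derivativeFrom-lift : ∀ n H → lift (k[x].derivativeFrom n H) ≡ derivativeFrom n (lift H)
  derivativeFrom-lift n []      = ≡.refl
  derivativeFrom-lift n (a ∷ H) = ≡.cong₂ _∷_ (×-lift n a) (derivativeFrom-lift (suc n) H)

  derivative-lift : ∀ H → lift (k[x].derivative H) ≡ derivative (lift H)
  derivative-lift []      = ≡.refl
  derivative-lift (a ∷ H) = derivativeFrom-lift 1 H

  linear*From-lift : ∀ α q H → lift (kP.linear*From α q H) ≡ linear*From (proj₁ α) (proj₁ q) (lift H)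
  linear*From-lift α q []      = ≡.refl
  linear*From-lift α q (a ∷ H) = ≡.cong (_ ∷_) (linear*From-lift α a H)

  lift-≋⇒≋ : ∀ {G H} → lift G ≋ lift H → G kP.≋ H
  lift-≋⇒≋ {G} {H} eq .kP.at n = ≈⇒M (trans (reflexive (≡.sym (coeff-lift G n)))
    (trans (eq .at n) (reflexive (coeff-lift H n))))

  Integral : Poly → Set p
  Integral f = ∀ n → O (coeff f n)

  reduce : ∀ f → Integral f → ∃[ H ] lift H ≡ f
  reduce []      f∈O = [] , ≡.refl
  reduce (a ∷ f) f∈O with reduce f (f∈O ∘ suc)
  ... | H , eq = (a , f∈O 0) ∷ H , ≡.cong (a ∷_) eq

  lift-integral : ∀ H → Integral (lift H)
  lift-integral H n = ≡.subst O (≡.sym (coeff-lift H n)) (proj₂ (k[x].coeff H n))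

  -- The coefficients of f are recovered from the top down: each is a coefficient of the product
  -- plus α times the next coefficient of f.
  linear*-integral⁻ : ∀ {α} f → O α → Integral (linear* α f) → Integral f
  linear*-integral⁻ {α} f α∈O αf∈O = descend f (λ n → O-resp (coeff-linear*-suc α f n) (αf∈O (suc n)))
    where
    descend : ∀ f → (∀ n → O (coeff f n - α * coeff f (suc n))) → Integral f
    descend []      f∈O n       = 0∈O
    descend (a ∷ f) f∈O (suc n) = descend f (f∈O ∘ suc) n
    descend (a ∷ f) f∈O zero    = O-resp (solve 2 (λ x y → (x :- y) :+ y := x) refl a (α * coeff f 0))
      (O-+ (f∈O 0) (O-* α∈O (descend f (f∈O ∘ suc) 0)))

  -- If α lies outside O then x - α is -α times 1 - α⁻¹ x, which reduces to a unit.
  split-reduction : ∀ {q} {Q : Pred Carrier q} L H a → lift H ≋ linears* L (a ∷ []) →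
                    All (λ α → O α → Q α) L →
                    ∃[ L̄ ] ∃[ ā ] H kP.≋ kP.linears* L̄ (ā ∷ []) × All (Q ∘ proj₁) L̄
  split-reduction []      H a H≋ [] =
    [] , k[x].coeff H 0 , kP.≋-intro (λ
      { zero    → k.refl {k[x].coeff H 0}
      ; (suc n) → ≈⇒M (trans (reflexive (≡.sym (coeff-lift H (suc n)))) (H≋ .at (suc n)))
      }) , []
  split-reduction (α ∷ L) H a H≋ (Qα ∷ QL) with O? α
  ... | yes α∈O =
    let f               = linears* L (a ∷ [])
        f∈O             = linear*-integral⁻ f α∈O (λ n → O-resp (H≋ .at n) (lift-integral H n))
        F , F≡f         = reduce f f∈O
        L̄ , ā , F≋ , QL̄ = split-reduction L F a (≡.subst (_≋ f) (≡.sym F≡f) ≋-refl) QL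
        f≡F             = ≡.trans (≡.cong (linear* α) (≡.sym F≡f))
                                  (≡.sym (linear*From-lift (α , α∈O) k.0# F))
        H≋F             = lift-≋⇒≋ {H} {kP.linear* (α , α∈O) F} (≡.subst (lift H ≋_) f≡F H≋)
    in (α , α∈O) ∷ L̄ , ā , kP.≋-trans H≋F (kP.linear*-cong (k.refl {α , α∈O}) F≋) , Qα α∈O ∷ QL̄
  ... | no  α∉O =
    let F , F≡f         = reduce (- α ⊛ f) f∈O
        -αf≋            = ≋-sym (linears*-⊛ L (- α) (a ∷ []))
        F≋-αf           = ≡.subst (_≋ linears* L (- α * a ∷ [])) (≡.sym F≡f) -αf≋
        L̄ , ā , F≋ , QL̄ = split-reduction L F (- α * a) F≋-αf QL
    in L̄ , ā , kP.≋-trans (H≋F F F≡f) F≋ , QL̄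
    where
    f = linears* L (a ∷ [])
    α⁻¹,αα⁻¹≈1 = inverse α (λ α≈0 → α∉O (O-resp (sym α≈0) 0∈O))
    α⁻¹ = proj₁ α⁻¹,αα⁻¹≈1
    αα⁻¹≈1 = proj₂ α⁻¹,αα⁻¹≈1

    α⁻¹∈M : M α⁻¹
    α⁻¹∈M = inverse∈M αα⁻¹≈1 α∉O

    H₀ : coeff (lift H) 0 ≈ coeff (- α ⊛ f) 0
    H₀ = begin
      coeff (lift H) 0         ≈⟨ H≋ .at 0 ⟩
      coeff (linear* α f) 0    ≈⟨ coeff-linear*-zero α f ⟩
      - (α * coeff f 0)
        ≈⟨ solve 2 (λ α x → :- (α :* x) := (:- α) :* x) refl α (coeff f 0) ⟩
      - α * coeff f 0          ≈⟨ coeff-⊛ (- α) f 0 ⟨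
      coeff (- α ⊛ f) 0        ∎

    Hₙ₊₁ : ∀ n → coeff (lift H) (suc n) - coeff (- α ⊛ f) (suc n) ≈ - (coeff (- α ⊛ f) n * α⁻¹)
    Hₙ₊₁ n = begin
      coeff (lift H) (suc n) - coeff (- α ⊛ f) (suc n)
        ≈⟨ -cong (trans (H≋ .at (suc n)) (coeff-linear*-suc α f n)) (coeff-⊛ (- α) f (suc n)) ⟩
      (coeff f n - α * coeff f (suc n)) - - α * coeff f (suc n)
        ≈⟨ solve 3 (λ α x y → (x :- α :* y) :- (:- α) :* y := x) refl _ _ _ ⟩
      coeff f n                            ≈⟨ *-identityˡ _ ⟨
      1# * coeff f n                       ≈⟨ *-congʳ αα⁻¹≈1 ⟨
      α * α⁻¹ * coeff f n
        ≈⟨ solve 3 (λ α α⁻¹ x → α :* α⁻¹ :* x := :- ((:- α) :* x :* α⁻¹)) refl _ _ _ ⟩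
      - (- α * coeff f n * α⁻¹)            ≈⟨ -‿cong (*-congʳ (coeff-⊛ (- α) f n)) ⟨
      - (coeff (- α ⊛ f) n * α⁻¹)          ∎

    -- Induction upwards: once coefficient n of -α f is integral, its coefficient n + 1 differs from
    -- that of H by a multiple of α⁻¹, an element of M.
    f∈O : Integral (- α ⊛ f)
    f∈O zero    = O-resp H₀ (lift-integral H 0)
    f∈O (suc n) = O-resp (solve 2 (λ x y → x :- (x :- y) := y) refl _ _)
      (O-- (lift-integral H (suc n)) (M⇒O (M-resp (sym (Hₙ₊₁ n)) (M-neg (M-* (f∈O n) α⁻¹∈M)))))

    H≋F : ∀ F → lift F ≡ - α ⊛ f → H kP.≋ F
    H≋F F F≡f .kP.at n = ≡.subst₂ (λ x y → M (x - y)) (coeff-lift H n)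
        (≡.trans (≡.cong (λ g → coeff g n) (≡.sym F≡f)) (coeff-lift F n)) (H-f∈M n)
      where
      H-f∈M : ∀ n → M (coeff (lift H) n - coeff (- α ⊛ f) n)
      H-f∈M zero    = ≈⇒M H₀
      H-f∈M (suc n) = M-resp (sym (Hₙ₊₁ n)) (M-neg (M-* (f∈O n) α⁻¹∈M))

  module _ (N : ℕ) (N! : ∀ k → suc k ℕ.≤ N → ¬ M (suc k · 1#)) where

    -- The reduction of `0# ∷ t` has the distinct roots 0 and 1, so `distinct-roots⇒constant` makes
    -- its nonconstant coefficients vanish. But one of them lies outside M.
    primitive-⊥ : ∀ t L a → Integral t → VanishesFrom N t → ∃[ n ] ¬ M (coeff t n) →
                   derivative (0# ∷ t) ≋ linears* L (a ∷ []) →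
                   M (eval (0# ∷ t) 1#) → All (λ α → O α → M (eval (0# ∷ t) α)) L → ⊥
    primitive-⊥ t L a t∈O vanishes (n , tₙ∉M) t′≋ t[1]∈M t[L]∈M with reduce t t∈O
    ... | T , ≡.refl =
      let G′≋L             = ≡.subst (_≋ linears* L (a ∷ [])) (≡.sym (derivative-lift G)) t′≋
          L̄ , ā , G′≋ , QL̄ = split-reduction L (k[x].derivative G) a G′≋L t[L]∈M
      in tₙ∉M (M-resp (trans (x-0≈x _) (reflexive (≡.sym (coeff-lift T n))))
        (kD.distinct-roots⇒constant G k.0# k.1# N L̄ ā (k.1≉0 ∘ k.sym {k.0#} {k.1#})
        (≈⇒M (trans (+-identityˡ _) (zeroˡ (proj₁ (k[x].eval T k.0#))))) (root {k.1#} t[1]∈M)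
        (λ k k<N → N! k k<N ∘ M-resp (trans (x-0≈x _) (reflexive (×-lift (suc k) k.1#))))
        G-vanishes G′≋ (All.map (λ {x} → root {x}) QL̄) n))
      where
      G = k.0# ∷ T

      root : ∀ {x} → M (eval (lift G) (proj₁ x)) → k[x].eval G x k.≈ k.0#
      root {x} = M-resp (trans (reflexive (eval-lift G x)) (sym (x-0≈x _)))

      G-vanishes : kP.VanishesFrom (suc N) G
      G-vanishes (suc n) (s≤s N≤n) = ≈⇒M (trans (reflexive (≡.sym (coeff-lift T n))) (vanishes n N≤n))

  -- Maxima of polynomials on discs

  eval∈M : ∀ f {x} → (∀ n → M (coeff f n)) → O x → M (eval f x)
  eval∈M []      f∈M x∈O = 0∈M
  eval∈M (a ∷ f) f∈M x∈O = M-+ (f∈M 0) (M-* x∈O (eval∈M f (f∈M ∘ suc) x∈O))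

  O-^ : ∀ {x} n → O x → O (x ^ n)
  O-^ zero    x∈O = 1∈O
  O-^ (suc n) x∈O = O-* x∈O (O-^ n x∈O)

  -- A coefficient of minimal valuation.
  record Pivot (f : Poly) : Set (c ⊔ ℓ ⊔ p) where
    field
      value inv  : Carrier
      isInverse  : value * inv ≈ 1#
      integral   : Integral (inv ⊛ f)
      index      : ℕ
      isCoeff    : coeff f index ≈ value

  pivot : Decidable _≈_ → ∀ f → f ≋ [] ⊎ Pivot f
  pivot _≟_ []      = inj₁ ≋-refl
  pivot _≟_ (a ∷ f) with pivot _≟_ f | a ≟ 0#
  ... | inj₁ f≋[] | yes a≈0 = inj₁ (≋-intro λ { zero → a≈0 ; (suc n) → f≋[] .at n })
  ... | inj₁ f≋[] | no  a≉0 = inj₂ (record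
    { value = a ; inv = a⁻¹ ; isInverse = aa⁻¹≈1 ; index = 0 ; isCoeff = refl
    ; integral = λ { zero → O-resp (trans (sym aa⁻¹≈1) (*-comm a a⁻¹)) 1∈O
                   ; (suc n) → O-resp (begin
                       0#                   ≈⟨ zeroʳ a⁻¹ ⟨
                       a⁻¹ * 0#             ≈⟨ *-congˡ (f≋[] .at n) ⟨
                       a⁻¹ * coeff f n      ≈⟨ coeff-⊛ a⁻¹ f n ⟨
                       coeff (a⁻¹ ⊛ f) n    ∎) 0∈O }
    })
    where
    a⁻¹ = proj₁ (inverse a a≉0)
    aa⁻¹≈1 = proj₂ (inverse a a≉0)
  ... | inj₂ P | yes a≈0 = inj₂ (record
    { Pivot P hiding (integral; index)
    ; index = suc (Pivot.index P)
    ; integral = λ { zero    → O-resp (trans (sym (zeroʳ _)) (*-congˡ (sym a≈0))) 0∈O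
                   ; (suc n) → Pivot.integral P n }
    })
  ... | inj₂ P | no a≉0 with O? (Pivot.inv P * a)
  ...   | yes a/b∈O = inj₂ (record
    { Pivot P hiding (integral; index)
    ; index = suc (Pivot.index P)
    ; integral = λ { zero → a/b∈O ; (suc n) → Pivot.integral P n }
    })
  ...   | no  a/b∉O = inj₂ (record
    { value = a ; inv = a⁻¹ ; isInverse = aa⁻¹≈1 ; index = 0 ; isCoeff = refl
    ; integral = λ { zero → O-resp (trans (sym aa⁻¹≈1) (*-comm a a⁻¹)) 1∈O
                   ; (suc n) → O-resp (f/a n) (O-* (M⇒O b/a∈M) (integral n)) }
    })
    where
    open Pivot P
    a⁻¹ = proj₁ (inverse a a≉0)
    aa⁻¹≈1 = proj₂ (inverse a a≉0)

    b/a∈M : M (value * a⁻¹)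
    b/a∈M = inverse∈M (begin
      inv * a * (value * a⁻¹)
        ≈⟨ solve 4
             (λ b⁻¹ a b a⁻¹ → b⁻¹ :* a :* (b :* a⁻¹) := b :* b⁻¹ :* (a :* a⁻¹))
             refl inv a value a⁻¹ ⟩
      value * inv * (a * a⁻¹)      ≈⟨ *-cong isInverse aa⁻¹≈1 ⟩
      1# * 1#                      ≈⟨ *-identityˡ 1# ⟩
      1#                           ∎) a/b∉O

    f/a : ∀ n → value * a⁻¹ * coeff (inv ⊛ f) n ≈ coeff (a⁻¹ ⊛ f) n
    f/a n = begin
      value * a⁻¹ * coeff (inv ⊛ f) n      ≈⟨ *-congˡ (coeff-⊛ inv f n) ⟩
      value * a⁻¹ * (inv * coeff f n)
        ≈⟨ solve 4
             (λ b a⁻¹ b⁻¹ x → b :* a⁻¹ :* (b⁻¹ :* x) := b :* b⁻¹ :* (a⁻¹ :* x))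
             refl value a⁻¹ inv _ ⟩
      value * inv * (a⁻¹ * coeff f n)      ≈⟨ trans (*-congʳ isInverse) (*-identityˡ _) ⟩
      a⁻¹ * coeff f n                      ≈⟨ coeff-⊛ a⁻¹ f n ⟨
      coeff (a⁻¹ ⊛ f) n                    ∎

  x≉0⇒x^n*y≈0⇒y≈0 : ∀ {x} n {y} → x ≉ 0# → x ^ n * y ≈ 0# → y ≈ 0#
  x≉0⇒x^n*y≈0⇒y≈0 zero    x≉0 eq = trans (sym (*-identityˡ _)) eq
  x≉0⇒x^n*y≈0⇒y≈0 (suc n) x≉0 eq =
    x≉0⇒x^n*y≈0⇒y≈0 n x≉0 (x*y≈0∧x≉0⇒y≈0 (trans (sym (*-assoc _ _ _)) eq) x≉0)

  coeff-⊛-dilate : ∀ w t n → coeff (w ⊛ dilate w t) n ≈ w ^ suc n * coeff t n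
  coeff-⊛-dilate w t n = coeff-dilate w (0# ∷ t) (suc n)

  -- Holds of 0#, 1# and - 1#, the possible values of B - B(0) at the points of interest.
  Discrete : Pred Carrier (ℓ ⊔ p)
  Discrete x = O x × (M x → x ≈ 0#)

  module _ (N : ℕ) (N! : ∀ k → suc k ℕ.≤ N → ¬ M (suc k · 1#))
           (t : Poly) (L : List Carrier) (a : Carrier) (t-vanishes : VanishesFrom N t)
           (f′≋ : derivative (0# ∷ t) ≋ linears* L (a ∷ [])) where
    private
      f = 0# ∷ t

    -- M (Pivot.inv P * y) says that y is smaller than the maximum of f on the disc
    -- ∣x∣ ≤ ∣w∣.
    disc-⊥ : ∀ {w w⁻¹} → w * w⁻¹ ≈ 1# → (P : Pivot (w ⊛ dilate w t)) →
             M (Pivot.inv P * eval f w) →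
             All (λ α → O (w⁻¹ * α) → M (Pivot.inv P * eval f α)) L → ⊥
    disc-⊥ {w} {w⁻¹} ww⁻¹≈1 P f[w]∈M f[L]∈M =
      primitive-⊥ N N! (rescale inv w t) (map (w⁻¹ *_) L) (inv * w * b) integral vanishes
        (index , unit) g′≋
        (M-resp (sym (g[x]≈ (*-identityʳ w))) f[w]∈M)
        (All.map⁺ (All.map (λ {α} f[α]∈M α∈O → M-resp (sym (g[x]≈ (ww⁻¹x≈x ww⁻¹≈1 α))) (f[α]∈M α∈O))
                           f[L]∈M))
      where
      open Pivot P
      b = proj₁ (dilate-linears* ww⁻¹≈1 L a)
      f′≋L = proj₂ (dilate-linears* ww⁻¹≈1 L a)
      g = 0# ∷ rescale inv w t

      g′≋ : derivative g ≋ linears* (map (w⁻¹ *_) L) (inv * w * b ∷ [])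
      g′≋ = ≋R.begin
        derivative g                                        ≋R.≈⟨ derivative-rescale inv w t ⟩
        (inv * w) ⊛ dilate w (derivative f)                 ≋R.≈⟨ ⊛-cong _ (dilate-cong w f′≋) ⟩
        (inv * w) ⊛ dilate w (linears* L (a ∷ []))          ≋R.≈⟨ ⊛-cong _ f′≋L ⟩
        (inv * w) ⊛ linears* (map (w⁻¹ *_) L) (b ∷ [])      ≋R.≈⟨ linears*-⊛ (map (w⁻¹ *_) L) _ _ ⟨
        linears* (map (w⁻¹ *_) L) (inv * w * b ∷ [])        ≋R.∎
        where module ≋R = ≋-Reasoning

      g[x]≈ : ∀ {x y} → w * x ≈ y → eval g x ≈ inv * eval f y
      g[x]≈ {x} wx≈y = trans (eval-rescale inv w t x) (*-congˡ (eval-cong {f} ≋-refl wx≈y))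

      vanishes : VanishesFrom N (rescale inv w t)
      vanishes n N≤n = begin
        coeff (rescale inv w t) n          ≈⟨ coeff-rescale inv w t n ⟩
        inv * (w ^ suc n * coeff t n)
          ≈⟨ *-congˡ (trans (*-congˡ (t-vanishes n N≤n)) (zeroʳ _)) ⟩
        inv * 0#                           ≈⟨ zeroʳ inv ⟩
        0#                                 ∎

      unit : ¬ M (coeff (rescale inv w t) index)
      unit = 1∉M ∘ M-resp (begin
        coeff (inv ⊛ (w ⊛ dilate w t)) index    ≈⟨ coeff-⊛ inv (w ⊛ dilate w t) index ⟩
        inv * coeff (w ⊛ dilate w t) index      ≈⟨ *-congˡ isCoeff ⟩
        inv * value                             ≈⟨ trans (*-comm inv value) isInverse ⟩
        1#                                      ∎)

    -- If f exceeds 1 on the disc ∣x∣ ≤ ∣u∣, its values at u and at the critical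
    -- points are small compared with its maximum.  Otherwise f is smaller than 1
    -- on the disc ∣x∣ ≤ ∣um∣, so it vanishes at um and at the critical points
    -- therein.
    nested-discs-⊥ : ∀ {u m} → Decidable _≈_ → ¬ t ≋ [] → u * m ≉ 0# → M m →
                     Discrete (eval f u) → Discrete (eval f (u * m)) →
                     All (λ α → Discrete (eval f α)) L → ⊥
    nested-discs-⊥ {u} {m} _≟_ t≉0 v≉0 m∈M f[u] f[v] f[L] with pivot _≟_ (u ⊛ dilate u t)
    ... | inj₁ s≋[] = t≉0 (≋-intro λ n → x≉0⇒x^n*y≈0⇒y≈0 (suc n) u≉0
                        (trans (sym (coeff-⊛-dilate u t n)) (s≋[] .at n)))
      where
      u≉0 : u ≉ 0#
      u≉0 u≈0 = v≉0 (trans (*-congʳ u≈0) (zeroˡ m))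
    ... | inj₂ P with O? (Pivot.value P)
    ...   | no  value∉O = disc-⊥ uu⁻¹≈1 P (small f[u]) (All.map (λ f[α] _ → small f[α]) f[L])
      where
      open Pivot P
      u≉0 : u ≉ 0#
      u≉0 u≈0 = v≉0 (trans (*-congʳ u≈0) (zeroˡ m))
      uu⁻¹≈1 = proj₂ (inverse u u≉0)

      -- A maximum outside O has its inverse in M, and integral multiples of that inverse stay in M.
      small : ∀ {x} → Discrete x → M (inv * x)
      small (x∈O , _) = M-resp (*-comm _ inv) (M-* x∈O (inverse∈M isInverse value∉O))
    ...   | yes value∈O = case-v (pivot _≟_ (v ⊛ dilate v t))
      where
      open Pivot P
      v = u * m
      vv⁻¹≈1 = proj₂ (inverse v v≉0)

      s∈O : Integral (u ⊛ dilate u t)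
      s∈O n = O-resp (begin
        value * coeff (inv ⊛ (u ⊛ dilate u t)) n
          ≈⟨ *-congˡ (coeff-⊛ inv (u ⊛ dilate u t) n) ⟩
        value * (inv * coeff (u ⊛ dilate u t) n)    ≈⟨ ww⁻¹x≈x isInverse _ ⟩
        coeff (u ⊛ dilate u t) n                    ∎) (O-* value∈O (integral n))

      -- The Schwarz lemma: compared with f(u x), which is integral, the coefficient of degree n + 1
      -- gains the factor m to the power n + 1, and a single m in M suffices. The constant term is
      -- 0.
      dilated∈M : ∀ n → M (coeff (dilate v f) n)
      dilated∈M zero    = 0∈M
      dilated∈M (suc n) = M-resp (begin
        m ^ n * coeff (u ⊛ dilate u t) n * m       ≈⟨ *-congʳ (*-congˡ (coeff-⊛-dilate u t n)) ⟩
        m ^ n * (u ^ suc n * coeff t n) * m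
          ≈⟨ solve 4 (λ mⁿ uⁿ x m → mⁿ :* (uⁿ :* x) :* m := uⁿ :* (m :* mⁿ) :* x) refl _ _ _ m ⟩
        u ^ suc n * m ^ suc n * coeff t n          ≈⟨ *-congʳ (^-distrib-* u m (suc n)) ⟨
        v ^ suc n * coeff t n                      ≈⟨ coeff-⊛-dilate v t n ⟨
        coeff (dilate v f) (suc n)                 ∎) (M-* (O-* (O-^ n (M⇒O m∈M)) (s∈O n)) m∈M)

      -- The value f(α) is that of f(v x) at the integral point v⁻¹ α, hence lies in M; among
      -- discrete values this leaves only 0.
      root : ∀ {α} → O (proj₁ (inverse v v≉0) * α) → Discrete (eval f α) → eval f α ≈ 0#
      root {α} α∈O (_ , f[α]∈M⇒0) = f[α]∈M⇒0 (M-resp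
        (trans (eval-dilate v f _) (eval-cong {f} ≋-refl (ww⁻¹x≈x vv⁻¹≈1 α)))
        (eval∈M (dilate v f) dilated∈M α∈O))

      scaled-root : ∀ b {x} → x ≈ 0# → M (b * x)
      scaled-root b x≈0 = M-resp (sym (trans (*-congˡ x≈0) (zeroʳ b))) 0∈M

      case-v : v ⊛ dilate v t ≋ [] ⊎ Pivot (v ⊛ dilate v t) → ⊥
      case-v (inj₁ s≋[]) = t≉0 (≋-intro λ n → x≉0⇒x^n*y≈0⇒y≈0 (suc n) v≉0
                             (trans (sym (coeff-⊛-dilate v t n)) (s≋[] .at n)))
      -- Values equal to 0 are small compared with any maximum, however small the maximum on the
      -- inner disc may be.
      case-v (inj₂ P′)   = disc-⊥ vv⁻¹≈1 P′
        (scaled-root _ (root (O-resp (trans (sym vv⁻¹≈1) (*-comm v _)) 1∈O) f[v]))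
        (All.map (λ f[α] α∈O → scaled-root _ (root α∈O f[α])) f[L])

-- Valuations

infix 4 _≤⁺?_

_≤⁺?_ : Decidable _≤⁺_
_≤⁺?_ = ≤⁺.≤⁺-dec ℚ._≤?_

≤⁺-trans : ∀ {x y z} → x ≤⁺ y → y ≤⁺ z → x ≤⁺ z
≤⁺-trans = ≤⁺.≤⁺-trans ℚ.≤-trans

⊓⁺-sel : ∀ x y → x ⊓⁺ y ≡ x ⊎ x ⊓⁺ y ≡ y
⊓⁺-sel [ a ] [ b ] with ℚ.⊓-sel a b
... | inj₁ eq = inj₁ (≡.cong [_] eq)
... | inj₂ eq = inj₂ (≡.cong [_] eq)
⊓⁺-sel [ a ] ⊤⁺    = inj₁ ≡.refl
⊓⁺-sel ⊤⁺    y     = inj₂ ≡.refl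

+⁺-mono-≤⁺ : ∀ {x y} → [ 0ℚ ] ≤⁺ x → [ 0ℚ ] ≤⁺ y → [ 0ℚ ] ≤⁺ x +⁺ y
+⁺-mono-≤⁺ {[ a ]} {[ b ]} [ 0≤a ] [ 0≤b ] = [ ℚ.+-mono-≤ 0≤a 0≤b ]
+⁺-mono-≤⁺ {[ a ]} {⊤⁺}    _       _       = _ ≤⊤⁺
+⁺-mono-≤⁺ {⊤⁺}    {y}     _       _       = _ ≤⊤⁺

+⁺-mono-≰⁺ : ∀ {x y} → [ 0ℚ ] ≤⁺ x → ¬ y ≤⁺ [ 0ℚ ] → ¬ x +⁺ y ≤⁺ [ 0ℚ ]
+⁺-mono-≰⁺ {[ a ]} {[ b ]} [ 0≤a ] y≰0 [ a+b≤0 ] =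
  ℚ.<-irrefl ≡.refl (ℚ.<-≤-trans (ℚ.+-mono-≤-< 0≤a (ℚ.≰⇒> (y≰0 ∘ [_]))) a+b≤0)

a+a≡0⇒a≡0 : ∀ a → a ℚ.+ a ≡ 0ℚ → a ≡ 0ℚ
a+a≡0⇒a≡0 a eq = ℚ.≤-antisym
  (ℚ.≮⇒≥ λ 0<a → ℚ.<-irrefl (≡.sym eq) (ℚ.+-mono-< {0ℚ} {a} {0ℚ} {a} 0<a 0<a))
  (ℚ.≮⇒≥ λ a<0 → ℚ.<-irrefl eq (ℚ.+-mono-< {a} {0ℚ} {a} {0ℚ} a<0 a<0))

module Valuation {c ℓ} {K : Field c ℓ} {ν : Field.Carrier K → ℚ ⁺} (isValuation : IsValuation K ν) where
  open Field K
  open IsValuation isValuation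
  open import Algebra.Properties.Ring ring using (-1*x≈-x; -‿involutive)
  open PolynomialProperties K using (x-y≈0⇒x≈y; x≈y⇒x-y≈0)

  ν[0] : ν 0# ≡ ⊤⁺
  ν[0] = Equivalence.from (ν≡∞⇔x≈0 0#) refl

  ν[1] : ν 1# ≡ [ 0ℚ ]
  ν[1] with ν 1# | ν-* 1# 1# | ν-cong (*-identityˡ 1#) | ν≡∞⇔x≈0 1#
  ... | ⊤⁺    | _  | _   | ν≡∞ = contradiction (Equivalence.to ν≡∞ ≡.refl) 1≉0
  ... | [ a ] | ν* | ν≡a | _   = ≡.cong [_] (identityʳ-unique a a ([]-injective (≡.trans (≡.sym ν*) ν≡a)))

  -- The square of -1 is 1, so twice its valuation is 0.
  ν[-1] : ν (- 1#) ≡ [ 0ℚ ]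
  ν[-1] = double≡0 (≡.trans (≡.sym (ν-* (- 1#) (- 1#)))
    (≡.trans (ν-cong (trans (-1*x≈-x (- 1#)) (-‿involutive 1#))) ν[1]))
    where
    double≡0 : ∀ {a} → a +⁺ a ≡ [ 0ℚ ] → a ≡ [ 0ℚ ]
    double≡0 {[ a ]} eq = ≡.cong [_] (a+a≡0⇒a≡0 a ([]-injective eq))

  ν-dec : ∀ (a : ℚ ⁺) → Dec (a ≡ ⊤⁺)
  ν-dec [ a ] = no λ ()
  ν-dec ⊤⁺    = yes ≡.refl

  -- The valuation decides equality: it is ∞ exactly at 0, and ∞ is a separate constructor.
  _≟_ : Decidable _≈_
  x ≟ y = map′ (x-y≈0⇒x≈y ∘ Equivalence.to (ν≡∞⇔x≈0 (x - y)))
               (Equivalence.from (ν≡∞⇔x≈0 (x - y)) ∘ x≈y⇒x-y≈0)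
               (ν-dec (ν (x - y)))

  -- The negated inequality for `M` expresses a positive valuation and includes ∞.
  valuationRing : ValuationRing K 0ℓ
  valuationRing = record
    { O = λ x → [ 0ℚ ] ≤⁺ ν x
    ; M = λ x → ¬ ν x ≤⁺ [ 0ℚ ]
    ; O? = λ x → [ 0ℚ ] ≤⁺? ν x
    ; M? = λ x → ¬? (ν x ≤⁺? [ 0ℚ ])
    ; O-resp = λ x≈y → ≡.subst ([ 0ℚ ] ≤⁺_) (ν-cong x≈y)
    ; M-resp = λ x≈y → ≡.subst (λ a → ¬ a ≤⁺ [ 0ℚ ]) (ν-cong x≈y)
    ; M⇒O = λ {x} → M⇒O (ν x)
    ; 0∈M = λ 0≤0 → ⊤≰0 (≡.subst (_≤⁺ [ 0ℚ ]) ν[0] 0≤0)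
    ; 1∈O = 0≤ ν[1]
    ; 1∉M = λ 1∈M → 1∈M (≡.subst (_≤⁺ [ 0ℚ ]) (≡.sym ν[1]) [ ℚ.≤-refl ])
    ; O-+ = λ {x} {y} x∈O y∈O → ≤⁺-trans (⊓-glb (ν x) (ν y) x∈O y∈O) (ν-+ x y)
    ; O-* = λ {x} {y} x∈O y∈O → ≡.subst ([ 0ℚ ] ≤⁺_) (≡.sym (ν-* x y)) (+⁺-mono-≤⁺ x∈O y∈O)
    ; O-neg = λ {x} x∈O → ≡.subst ([ 0ℚ ] ≤⁺_) (≡.trans (≡.sym (ν-* (- 1#) x)) (ν-cong (-1*x≈-x x)))
        (+⁺-mono-≤⁺ (0≤ ν[-1]) x∈O)
    ; M-+ = λ {x} {y} x∈M y∈M x+y≤0 → ⊓-glb′ (ν x) (ν y) x∈M y∈M (≤⁺-trans (ν-+ x y) x+y≤0)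
    ; M-* = λ {x} {y} x∈O y∈M → ≡.subst (λ a → ¬ a ≤⁺ [ 0ℚ ]) (≡.sym (ν-* x y)) (+⁺-mono-≰⁺ x∈O y∈M)
    ; inverse∈M = λ {x} {y} xy≈1 → inverse∈M (sum≡0 xy≈1)
    ; inverse∈O = λ {x} {y} xy≈1 x∉M → inverse∈O (sum≡0 xy≈1) (decidable-stable (ν x ≤⁺? [ 0ℚ ]) x∉M)
    }
    where
    0≤ : ∀ {x} → ν x ≡ [ 0ℚ ] → [ 0ℚ ] ≤⁺ ν x
    0≤ eq = ≡.subst ([ 0ℚ ] ≤⁺_) (≡.sym eq) [ ℚ.≤-refl ]

    ⊤≰0 : ¬ ⊤⁺ ≤⁺ [ 0ℚ ]
    ⊤≰0 ()

    M⇒O : ∀ a → ¬ a ≤⁺ [ 0ℚ ] → [ 0ℚ ] ≤⁺ a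
    M⇒O a a≰0 with ≤⁺.≤⁺-total ℚ.≤-total a [ 0ℚ ]
    ... | inj₁ a≤0 = contradiction a≤0 a≰0
    ... | inj₂ 0≤a = 0≤a

    ⊓-glb : ∀ a b → [ 0ℚ ] ≤⁺ a → [ 0ℚ ] ≤⁺ b → [ 0ℚ ] ≤⁺ a ⊓⁺ b
    ⊓-glb a b 0≤a 0≤b with ⊓⁺-sel a b
    ... | inj₁ eq = ≡.subst ([ 0ℚ ] ≤⁺_) (≡.sym eq) 0≤a
    ... | inj₂ eq = ≡.subst ([ 0ℚ ] ≤⁺_) (≡.sym eq) 0≤b

    ⊓-glb′ : ∀ a b → ¬ a ≤⁺ [ 0ℚ ] → ¬ b ≤⁺ [ 0ℚ ] → ¬ a ⊓⁺ b ≤⁺ [ 0ℚ ]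
    ⊓-glb′ a b a≰0 b≰0 a⊓b≤0 with ⊓⁺-sel a b
    ... | inj₁ eq = a≰0 (≡.subst (_≤⁺ [ 0ℚ ]) eq a⊓b≤0)
    ... | inj₂ eq = b≰0 (≡.subst (_≤⁺ [ 0ℚ ]) eq a⊓b≤0)

    sum≡0 : ∀ {x y} → x * y ≈ 1# → ν x +⁺ ν y ≡ [ 0ℚ ]
    sum≡0 {x} {y} xy≈1 = ≡.trans (≡.sym (ν-* x y)) (≡.trans (ν-cong xy≈1) ν[1])

    inverse∈M : ∀ {a b} → a +⁺ b ≡ [ 0ℚ ] → ¬ [ 0ℚ ] ≤⁺ a → ¬ b ≤⁺ [ 0ℚ ]
    inverse∈M {[ a ]} {[ b ]} eq a≱0 [ b≤0 ] =
      ℚ.<-irrefl ([]-injective eq) (ℚ.+-mono-<-≤ (ℚ.≰⇒> (a≱0 ∘ [_])) b≤0)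

    inverse∈O : ∀ {a b} → a +⁺ b ≡ [ 0ℚ ] → a ≤⁺ [ 0ℚ ] → [ 0ℚ ] ≤⁺ b
    inverse∈O {[ a ]} {[ b ]} eq [ a≤0 ] =
      [ ℚ.≮⇒≥ (λ b<0 → ℚ.<-irrefl ([]-injective eq) (ℚ.+-mono-≤-< a≤0 b<0)) ]

  open ValuationRing valuationRing using (O; M)

  ν≡0⇒∉M : ∀ {x} → ν x ≡ [ 0ℚ ] → ¬ M x
  ν≡0⇒∉M ν≡0 x∈M = x∈M (≡.subst (_≤⁺ [ 0ℚ ]) (≡.sym ν≡0) [ ℚ.≤-refl ])

  -- `O x → M x` is the form that ∣x∣ ≠ 1 takes in an abstract valuation ring.
  ν≢0⇒∉O∖M : ∀ {x} → ν x ≢ [ 0ℚ ] → O x → M x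
  ν≢0⇒∉O∖M ν≢0 x∈O x≤0 = ν≢0 (≤⁺.≤⁺-antisym-≡ ℚ.≤-antisym x≤0 x∈O)

-- Positive integers below p are p-adic units

multiplicity≡0 : ∀ p n → 0 ℕ.< n → n ℕ.< p → multiplicity p n ≡ 0
multiplicity≡0 p n 0<n n<p =
  ≡.cong length (List.filter-none (λ k → p ℕ.^ suc k ∣? n) (All.universal ∤n (upTo n)))
  where
  instance
    _ = ℕ.>-nonZero 0<n
    _ = ℕ.>-nonZero (ℕ.<-trans 0<n n<p)

  ∤n : ∀ k → ¬ p ℕ.^ suc k ∣ n
  ∤n k pᵏ∣n = ℕ.<⇒≱ n<p (ℕ.≤-trans (ℕ.m≤m*n p (p ℕ.^ k) {{ℕ.m^n≢0 p k}}) (∣⇒≤ pᵏ∣n))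

-- A fraction in lowest terms by construction, so that `ν-ℚ` sees its numerator and denominator; a
-- multiple of `1ℚ` by a variable does not reduce to one.
fromℕ : ℕ → ℚ
fromℕ n = mkℚ (ℤ.+ n) 0 (Coprimality.sym (Coprimality.1-coprimeTo n))

open SemiringMult (Field.semiring ℚ-field) using () renaming (_×_ to _×ℚ_)

×1≡fromℕ : ∀ n → n ×ℚ 1ℚ ≡ fromℕ n
×1≡fromℕ zero    = ≡.refl
×1≡fromℕ (suc n) = ≡.trans (≡.cong (1ℚ ℚ.+_) (×1≡fromℕ n)) (ℚ.toℚᵘ-injective
  (ℚᵘ.≃-trans (ℚ.toℚᵘ-homo-+ 1ℚ (fromℕ n)) (ℚᵘ.*≡* eq)))
  where
  eq : (ℤ.+ 1 ℤ.* ℤ.+ 1 ℤ.+ ℤ.+ n ℤ.* ℤ.+ 1) ℤ.* ℤ.+ 1 ≡ ℤ.+ suc n ℤ.* ℤ.+ 1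
  eq = ≡.cong (λ i → (ℤ.+ 1 ℤ.+ i) ℤ.* ℤ.+ 1) (ℤ.*-identityʳ (ℤ.+ n))

ν-ℚ-unit : ∀ p n → suc n ℕ.< p → ν-ℚ p (suc n ×ℚ 1ℚ) ≡ [ 0ℚ ]
ν-ℚ-unit p n n<p rewrite ×1≡fromℕ (suc n) with fromℕ (suc n) ℚ.≟ 0ℚ
... | yes ()
... | no _ = ≡.cong₂ (λ a b → [ (a ℤ.⊖ b) ℚ./ 1 ])
  (multiplicity≡0 p (suc n) (s≤s z≤n) n<p)
  (multiplicity≡0 p 1 (s≤s z≤n) (ℕ.≤-trans (s≤s (s≤s z≤n)) n<p))

-- Polynomials under a field homomorphism

module FieldHomomorphism {c₁ ℓ₁ c₂ ℓ₂} (F : Field c₁ ℓ₁) (K : Field c₂ ℓ₂)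
                         {φ : Field.Carrier F → Field.Carrier K}
                         (isHom : IsFieldHomomorphism F K φ) where
  private
    module F = Field F
    module F[x] = Polynomial F
    module FP = PolynomialProperties F
    module F× = SemiringMult F.semiring
    module K× = SemiringMult (Field.semiring K)
  open Field K
  open Polynomial K
  open PolynomialProperties K
  open IsRingHomomorphism isHom
  open SetoidReasoning setoid

  ×-homo : ∀ n x → φ (n F×.× x) ≈ n K×.× φ x
  ×-homo zero    x = 0#-homo
  ×-homo (suc n) x = trans (+-homo x _) (+-congˡ (×-homo n x))

  ×1-homo : ∀ n → φ (n F×.× F.1#) ≈ n K×.× 1#
  ×1-homo n = trans (×-homo n F.1#) (K×.×-congʳ n 1#-homo)

  ≉0-homo : ∀ {x} → x F.≉ F.0# → φ x ≉ 0#
  ≉0-homo {x} x≉0 φx≈0 with F.inverse x x≉0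
  ... | y , xy≈1 = 1≉0 (begin
    1#           ≈⟨ 1#-homo ⟨
    φ F.1#       ≈⟨ ⟦⟧-cong xy≈1 ⟨
    φ (x F.* y)  ≈⟨ *-homo x y ⟩
    φ x * φ y    ≈⟨ *-congʳ φx≈0 ⟩
    0# * φ y     ≈⟨ zeroˡ _ ⟩
    0#           ∎)

  φ-sub : ∀ x y → φ (x F.- y) ≈ φ x - φ y
  φ-sub x y = trans (+-homo x (F.- y)) (+-congˡ (-‿homo y))

  coeff-map : ∀ f n → coeff (map φ f) n ≈ φ (F[x].coeff f n)
  coeff-map []      n       = sym 0#-homo
  coeff-map (a ∷ f) zero    = refl
  coeff-map (a ∷ f) (suc n) = coeff-map f n

  eval-map : ∀ f x → eval (map φ f) (φ x) ≈ φ (F[x].eval f x)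
  eval-map []      x = sym 0#-homo
  eval-map (a ∷ f) x = begin
    φ a + φ x * eval (map φ f) (φ x)    ≈⟨ +-congˡ (*-congˡ (eval-map f x)) ⟩
    φ a + φ x * φ (F[x].eval f x)       ≈⟨ +-congˡ (*-homo _ _) ⟨
    φ a + φ (x F.* F[x].eval f x)       ≈⟨ +-homo _ _ ⟨
    φ (a F.+ x F.* F[x].eval f x)       ∎

  map-cong : ∀ {f g} → f FP.≋ g → map φ f ≋ map φ g
  map-cong {f} {g} f≋g .at n = trans (coeff-map f n) (trans (⟦⟧-cong (f≋g .FP.at n)) (sym (coeff-map g n)))

  map-derivativeFrom : ∀ k f → map φ (F[x].derivativeFrom k f) ≋ derivativeFrom k (map φ f)
  map-derivativeFrom k []      = ≋-refl
  map-derivativeFrom k (a ∷ f) = ≋-intro λ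
    { zero → ×-homo k a ; (suc n) → map-derivativeFrom (suc k) f .at n }

  map-derivative : ∀ f → map φ (F[x].derivative f) ≋ derivative (map φ f)
  map-derivative []      = ≋-refl
  map-derivative (a ∷ f) = map-derivativeFrom 1 f

  map-linear*From : ∀ α a f → map φ (FP.linear*From α a f) ≋ linear*From (φ α) (φ a) (map φ f)
  map-linear*From α a []      = ≋-refl
  map-linear*From α a (b ∷ f) = ≋-intro λ
    { zero    → trans (φ-sub a (α F.* b)) (-cong refl (*-homo α b))
    ; (suc n) → map-linear*From α b f .at n }

  map-linear* : ∀ α f → map φ (FP.linear* α f) ≋ linear* (φ α) (map φ f)
  map-linear* α f = ≋-intro λ
    { zero    → begin
        coeff (map φ (FP.linear* α f)) 0    ≈⟨ coeff-map (FP.linear* α f) 0 ⟩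
        φ (F[x].coeff (FP.linear* α f) 0)   ≈⟨ ⟦⟧-cong (FP.coeff-linear*-zero α f) ⟩
        φ (F.- (α F.* F[x].coeff f 0))      ≈⟨ trans (-‿homo _) (-‿cong (*-homo _ _)) ⟩
        - (φ α * φ (F[x].coeff f 0))        ≈⟨ -‿cong (*-congˡ (coeff-map f 0)) ⟨
        - (φ α * coeff (map φ f) 0)         ≈⟨ coeff-linear*-zero (φ α) (map φ f) ⟨
        coeff (linear* (φ α) (map φ f)) 0   ∎
    ; (suc n) → begin
        coeff (map φ (FP.linear* α f)) (suc n)    ≈⟨ coeff-map (FP.linear* α f) (suc n) ⟩
        φ (F[x].coeff (FP.linear* α f) (suc n))   ≈⟨ ⟦⟧-cong (FP.coeff-linear*-suc α f n) ⟩
        φ (F[x].coeff f n F.- α F.* F[x].coeff f (suc n))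
          ≈⟨ trans (φ-sub _ _) (-cong refl (*-homo _ _)) ⟩
        φ (F[x].coeff f n) - φ α * φ (F[x].coeff f (suc n))
          ≈⟨ -cong (coeff-map f n) (*-congˡ (coeff-map f (suc n))) ⟨
        coeff (map φ f) n - φ α * coeff (map φ f) (suc n)
          ≈⟨ coeff-linear*-suc (φ α) (map φ f) n ⟨
        coeff (linear* (φ α) (map φ f)) (suc n)   ∎ }

  map-linears* : ∀ L f → map φ (FP.linears* L f) ≋ linears* (map φ L) (map φ f)
  map-linears* []      f = ≋-refl
  map-linears* (α ∷ L) f = ≋-trans (map-linear* α (FP.linears* L f)) (linear*-cong refl (map-linears* L f))

-- Belyi polynomials over a valued field

module _ {c₂ ℓ₂ c₃ ℓ₃ r} {K : Field c₂ ℓ₂} (V : ValuationRing K r) (_≟_ : Decidable (Field._≈_ K))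
         (Q̄ : Field c₃ ℓ₃) {e : Field.Carrier Q̄ → Field.Carrier K} (e-isHom : IsFieldHomomorphism Q̄ K e)
         where
  private
    module Q̄ = Field Q̄
    module Q̄[x] = Polynomial Q̄
    module Q̄× = SemiringMult Q̄.semiring
    module Q̄P = PolynomialProperties Q̄
  open Field K
  open Polynomial K
  open PolynomialProperties K
  open SemiringMult semiring using () renaming (_×_ to _·_)
  open ValuationRing V
  open ValuationRingProperties V
  open FieldHomomorphism Q̄ K e-isHom
  open IsRingHomomorphism e-isHom
  open Belyi Q̄
  open CommutativeRingSolver commutativeRing using (solve; _:=_; _:+_; _:-_)
  open SetoidReasoning setoid

  Discrete-resp : ∀ {x y} → x ≈ y → Discrete x → Discrete y
  Discrete-resp x≈y (x∈O , x∈M⇒0) =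
    O-resp x≈y x∈O , λ y∈M → trans (sym x≈y) (x∈M⇒0 (M-resp (sym x≈y) y∈M))

  Discrete-0 : Discrete 0#
  Discrete-0 = 0∈O , λ _ → refl

  Discrete-1 : Discrete 1#
  Discrete-1 = 1∈O , λ 1∈M → contradiction 1∈M 1∉M

  Discrete-neg : ∀ {x} → Discrete x → Discrete (- x)
  Discrete-neg {x} (x∈O , x∈M⇒0) = O-neg x∈O ,
    λ -x∈M → trans (-‿cong (x∈M⇒0 (M-resp (-‿involutive x) (M-neg -x∈M)))) -0#≈0#
    where open import Algebra.Properties.Ring ring using (-‿involutive; -0#≈0#)

  difference-discrete : ∀ {x y} → Is0Or1 x → Is0Or1 y → Discrete (e x - e y)
  difference-discrete {x} {y} (inj₁ x≈0) (inj₁ y≈0) =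
    Discrete-resp (sym (x≈y⇒x-y≈0 (⟦⟧-cong (Q̄.trans x≈0 (Q̄.sym y≈0))))) Discrete-0
  difference-discrete {x} {y} (inj₂ x≈1) (inj₂ y≈1) =
    Discrete-resp (sym (x≈y⇒x-y≈0 (⟦⟧-cong (Q̄.trans x≈1 (Q̄.sym y≈1))))) Discrete-0
  difference-discrete {x} {y} (inj₂ x≈1) (inj₁ y≈0) = Discrete-resp (begin
    1#             ≈⟨ x-0≈x 1# ⟨
    1# - 0#        ≈⟨ -cong (trans (⟦⟧-cong x≈1) 1#-homo) (trans (⟦⟧-cong y≈0) 0#-homo) ⟨
    e x - e y      ∎) Discrete-1
  difference-discrete {x} {y} (inj₁ x≈0) (inj₂ y≈1) = Discrete-resp (begin
    - 1#           ≈⟨ +-identityˡ (- 1#) ⟨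
    0# - 1#        ≈⟨ -cong (trans (⟦⟧-cong x≈0) 0#-homo) (trans (⟦⟧-cong y≈1) 1#-homo) ⟨
    e x - e y      ∎) (Discrete-neg Discrete-1)

  split-belyi-⊥ : ∀ n b t L a → let B = b ∷ t in
                  (∀ k → suc k ℕ.≤ suc n → ¬ M (suc k · 1#)) →
                  IsNormalizedBelyi B → Q̄[x].HasDegree B (suc n) →
                  Q̄[x].derivative B Q̄P.≋ Q̄P.linears* L (a ∷ []) →
                  ∀ {z} → z Q̄.≉ Q̄.0# → (O (e z) → M (e z)) → ¬ Is0Or1 (Q̄[x].eval B z)
  split-belyi-⊥ n b t L a unit∉M isBelyi (Bₙ≉0 , B-vanishes) B′≋ {z} z≉0 z∉O∖M B[z] =
    conclusion (M? (e z))
    where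
    open IsNormalizedBelyi isBelyi
    B = b ∷ t
    s = map e t
    f = 0# ∷ s

    -- `derivative` discards the head of the list, so f and the image of B have the same derivative
    -- by computation although their constant terms differ.
    f′≋ : derivative f ≋ linears* (map e L) (e a ∷ [])
    f′≋ = ≋-trans (≋-sym (map-derivative B)) (≋-trans (map-cong B′≋) (map-linears* L (a ∷ [])))

    B[0]≈b : Q̄[x].eval B Q̄.0# Q̄.≈ b
    B[0]≈b = Q̄.trans (Q̄.+-congˡ (Q̄.zeroˡ (Q̄[x].eval t Q̄.0#))) (Q̄.+-identityʳ b)

    eval-f : ∀ x → eval f (e x) ≈ e (Q̄[x].eval B x) - e (Q̄[x].eval B Q̄.0#)
    eval-f x = begin
      0# + e x * eval s (e x)                  ≈⟨ +-congʳ (-‿inverseʳ (e b)) ⟨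
      (e b - e b) + e x * eval s (e x)
        ≈⟨ solve 2 (λ b y → (b :- b) :+ y := (b :+ y) :- b) refl (e b) _ ⟩
      (e b + e x * eval s (e x)) - e b
        ≈⟨ -cong (eval-map B x) (⟦⟧-cong (Q̄.sym B[0]≈b)) ⟩
      e (Q̄[x].eval B x) - e (Q̄[x].eval B Q̄.0#)  ∎

    discrete : ∀ x → Is0Or1 (Q̄[x].eval B x) → Discrete (eval f (e x))
    discrete x B[x] = Discrete-resp (sym (eval-f x)) (difference-discrete B[x] B[0])

    critical : All (λ α → Discrete (eval f α)) (map e L)
    critical = All.map⁺ (All.map
      (λ {α} root → discrete α (criticalValues α (Q̄.trans (Q̄P.eval-cong B′≋ Q̄.refl) root)))
      (Q̄P.linears*-roots L (a ∷ [])))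

    s≉0 : ¬ s ≋ []
    s≉0 s≋[] = ≉0-homo Bₙ≉0 (trans (sym (coeff-map t n)) (s≋[] .at n))

    s-vanishes : VanishesFrom (suc n) s
    s-vanishes m n<m = trans (coeff-map t m) (trans (⟦⟧-cong (B-vanishes (suc m) (s≤s n<m))) 0#-homo)

    f[1] : Discrete (eval f 1#)
    f[1] = Discrete-resp (eval-cong {f} ≋-refl 1#-homo) (discrete Q̄.1# B[1])

    f[z] : Discrete (eval f (e z))
    f[z] = discrete z B[z]

    nested-⊥ : ∀ {u m v} → u * m ≈ v → v ≉ 0# → M m → Discrete (eval f u) → Discrete (eval f v) → ⊥
    nested-⊥ um≈v v≉0 m∈M f[u] f[v] =
      nested-discs-⊥ (suc n) unit∉M s (map e L) (e a) s-vanishes f′≋ _≟_ s≉0 (v≉0 ∘ trans (sym um≈v)) m∈M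
        f[u] (Discrete-resp (eval-cong {f} ≋-refl (sym um≈v)) f[v]) critical

    conclusion : Dec (M (e z)) → ⊥
    -- If ∣z∣ < 1, the outer point is 1 and the ratio m of the two points is z.
    conclusion (yes z∈M) = nested-⊥ (*-identityˡ (e z)) (≉0-homo z≉0) z∈M f[1] f[z]
    -- Here z is outside M, hence by `z∉O∖M` outside O, and z⁻¹ lies in M: the outer point is z, the
    -- inner one is 1 and the ratio is z⁻¹.
    conclusion (no  z∉M) =
      let z⁻¹ , zz⁻¹≈1 = inverse (e z) (≉0-homo z≉0)
      in nested-⊥ zz⁻¹≈1 1≉0 (inverse∈M zz⁻¹≈1 (z∉M ∘ z∉O∖M)) f[z] f[1]

  belyi-degree-bound : ∀ n → (∀ k → suc k ℕ.≤ suc n → ¬ M (suc k · 1#)) →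
                       (∀ f m → Q̄[x].HasDegree f (suc m) → ∃[ x ] Q̄[x].eval f x Q̄.≈ Q̄.0#) →
                       ∀ {z} → z Q̄.≉ Q̄.0# → (O (e z) → M (e z)) →
                       ¬ HasBelyiOfDegree z (suc n)
  belyi-degree-bound n unit∉M closed z≉0 z∉O∖M ([] , _ , (Bₙ≉0 , _) , _) = Bₙ≉0 Q̄.refl
  belyi-degree-bound n unit∉M closed z≉0 z∉O∖M (B@(b ∷ t) , isBelyi , degree@(Bₙ≉0 , B-vanishes) , B[z]) =
    let L , a , B′≋ = Q̄P.split closed n (Q̄[x].derivative B) B′-degree
    in split-belyi-⊥ n b t L a unit∉M isBelyi degree B′≋ z≉0 z∉O∖M B[z]
    where
    -- Were this integer 0, its image would lie in M, contrary to `unit∉M`. Hence differentiation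
    -- lowers the degree of B by exactly one.
    n≉0 : suc n Q̄×.× Q̄.1# Q̄.≉ Q̄.0#
    n≉0 n≈0 = unit∉M n ℕ.≤-refl (M-resp (begin
      0#                       ≈⟨ 0#-homo ⟨
      e Q̄.0#                   ≈⟨ ⟦⟧-cong n≈0 ⟨
      e (suc n Q̄×.× Q̄.1#)      ≈⟨ ×1-homo (suc n) ⟩
      suc n · 1#               ∎) 0∈M)

    B′-degree : Q̄[x].HasDegree (Q̄[x].derivative B) n
    B′-degree =
      (λ B′ₙ≈0 → Bₙ≉0 (Q̄P.x*y≈0∧x≉0⇒y≈0 (Q̄.trans (Q̄.sym (Q̄P.coeff-derivative B n)) B′ₙ≈0) n≉0)) ,
      (λ m n<m → Q̄.trans (Q̄P.coeff-derivative B m)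
                         (Q̄.trans (Q̄.*-congˡ (B-vanishes (suc m) (s≤s n<m))) (Q̄.zeroʳ _)))

theorem3 : ∀ {c₁ ℓ₁ c₂ ℓ₂ c₃ ℓ₃ : Level}
    (p : ℕ) → Prime p →
    -- the field of p-adic numbers
    (Qp : Field c₁ ℓ₁) (νQp : Field.Carrier Qp → ℚ ⁺) (ι : ℚ → Field.Carrier Qp) →
    IsPAdicNumbers p Qp νQp ι →
    -- an algebraic closure of it, with the extended valuation
    (Q̄p : Field c₂ ℓ₂) (j : Field.Carrier Qp → Field.Carrier Q̄p) →
    IsAlgebraicClosure Qp Q̄p j →
    (νp : Field.Carrier Q̄p → ℚ ⁺) →
    IsExtendedValuation Qp νQp Q̄p νp j →
    -- an algebraic closure of ℚ embedded in it
    (Q̄ : Field c₃ ℓ₃) (i : ℚ → Field.Carrier Q̄) →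
    IsAlgebraicClosure ℚ-field Q̄ i →
    (e : Field.Carrier Q̄ → Field.Carrier Q̄p) →
    IsFieldHomomorphism Q̄ Q̄p e →
    ∀ (z : Field.Carrier Q̄) → Field._≉_ Q̄ z (Field.0# Q̄) → νp (e z) ≢ [ 0ℚ ] →
    ∀ (h : ℕ) → Belyi.IsBelyiHeight Q̄ z h → h ≥ p
theorem3 p _ Qp νQp ι Qp-isPAdic Q̄p j Q̄p-isClosure νp νp-extends Q̄ i Q̄-isClosure e e-isHom z z≉0 ν[z]≢0
  zero    ((B , isBelyi , (_ , B-vanishes) , _) , _) =
  -- Degree 0 would annihilate the leading coefficient that `nonconstant` provides.
  contradiction (B-vanishes (suc n) (s≤s z≤n)) (proj₁ Bₙ₊₁≉0)
  where
  n = proj₁ (Belyi.IsNormalizedBelyi.nonconstant isBelyi)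
  Bₙ₊₁≉0 = proj₂ (Belyi.IsNormalizedBelyi.nonconstant isBelyi)
theorem3 p _ Qp νQp ι Qp-isPAdic Q̄p j Q̄p-isClosure νp νp-extends Q̄ i Q̄-isClosure e e-isHom z z≉0 ν[z]≢0
  (suc n) (z-hasBelyi , _) = ℕ.≮⇒≥ λ n<p →
    belyi-degree-bound valuationRing _≟_ Q̄ e-isHom n
      (λ k k≤n → ν≡0⇒∉M (unit k (ℕ.≤-<-trans k≤n n<p)))
      (IsAlgebraicClosure.algebraicallyClosed Q̄-isClosure) z≉0 (ν≢0⇒∉O∖M ν[z]≢0) z-hasBelyi
  where
  open Valuation (IsExtendedValuation.isValuation νp-extends)
  open SemiringMult (Field.semiring Q̄p) using () renaming (_×_ to _·_)
  module Qp× = SemiringMult (Field.semiring Qp)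
  module Qp-completion = IsCompletion Qp-isPAdic
  module νp = IsValuation (IsExtendedValuation.isValuation νp-extends)
  module νQp = IsValuation Qp-completion.isValuation
  module jHom = FieldHomomorphism Qp Q̄p (IsAlgebraicClosure.isFieldHomomorphism Q̄p-isClosure)
  module ιHom = FieldHomomorphism ℚ-field Qp Qp-completion.isFieldHomomorphism

  -- The valuation is computed in ℚ, where `ν-ℚ` is explicit, and carried through the completion and
  -- the algebraic closure.
  unit : ∀ k → suc k ℕ.< p → νp (suc k · Field.1# Q̄p) ≡ [ 0ℚ ]
  unit k k<p = begin
    νp (suc k · Field.1# Q̄p)               ≡⟨ νp.ν-cong (jHom.×1-homo (suc k)) ⟨
    νp (j (suc k Qp×.× Field.1# Qp))       ≡⟨ IsExtendedValuation.extends νp-extends _ ⟩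
    νQp (suc k Qp×.× Field.1# Qp)          ≡⟨ νQp.ν-cong (ιHom.×1-homo (suc k)) ⟨
    νQp (ι (suc k ×ℚ 1ℚ))                  ≡⟨ Qp-completion.extends _ ⟩
    ν-ℚ p (suc k ×ℚ 1ℚ)                    ≡⟨ ν-ℚ-unit p k k<p ⟩
    [ 0ℚ ]                                 ∎
    where open ≡.≡-Reasoning
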